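{- Let $G=\mathrm{Aut}(\mathbb{Q})$ be the group of order-preserving bijections of $\mathbb{Q}$, with the topology of pointwise convergence. Then every two-dimensional topological similarity class is meager in $G\times G$; that is, for every pair $(f_1,g_1)\in G\times G$, the set of pairs $(f,g)\in G\times G$ that are topologically similar to $(f_1,g_1)$ is meager in $G\times G$.
   Context: $\mathbb{Q}$ is the set of rationals with its usual linear order. The topology on $G=\mathrm{Aut}(\mathbb{Q})$ has as basic open sets $U(p)=\{g\in G: g \text{ extends } p\}$, where $p$ ranges over order-preserving bijections between finite subsets of $\mathbb{Q}$. For a topological group $K$, a pair $(g_1,g_2)\in K^2$ is topologically similar to $(f_1,f_2)\in K^2$ if the map $g_i\mapsto f_i$ ($i=1,2$) extends to a group isomorphism $\langle g_1,g_2\rangle\to\langle f_1,f_2\rangle$ that is a homeomorphism with respect to the subspace topologies. This is an equivalence relation; its classes are the two-dimensional topological similarity classes. -}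

module Defs where

open import Algebra.Bundles using (Group)
open import Algebra.Morphism.Structures using (module GroupMorphisms)
open import Data.List.Base using (List; []; _∷_; _++_; map)
open import Data.List.Membership.Propositional using () renaming (_∈_ to _∈ˡ_)
open import Data.List.Relation.Unary.All as All using (All; []; _∷_)
open import Data.List.Relation.Unary.All.Properties using (++⁺; ++⁻ˡ; ++⁻ʳ)
open import Data.Nat.Base using (ℕ)
open import Data.Product.Base using (Σ; ∃; _×_; _,_; proj₁; proj₂)
open import Data.Product.Relation.Binary.Pointwise.NonDependent using (×-setoid)
open import Data.Rational.Base using (ℚ; _≤_)
open import Function.Base using (_on_)
open import Function.Definitions using (Inverseᵇ)
open import Level using (Level; 0ℓ; _⊔_) renaming (suc to lsuc)
open import Relation.Binary.Bundles using (Setoid)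
open import Relation.Binary.Core using (Rel)
open import Relation.Binary.Definitions using (_Respects_)
import Relation.Binary.Construct.On as On
open import Relation.Binary.Morphism.Structures using (IsOrderIsomorphism)
import Relation.Binary.Morphism.Construct.Composition as Composition
import Relation.Binary.Morphism.Construct.Identity as Identity
open import Relation.Binary.PropositionalEquality.Core using (_≡_; refl; sym; trans; cong; subst₂)
open import Relation.Unary using (Pred; _∈_; _⊆_; _∩_; _≬_; _⊢_; Empty; ⋃)

private
  variable
    ℓ : Level

-- A topology presented by a base.  Carriers are setoids, so basic open sets
-- are required to respect the equality of the carrier.
record Topology (S : Setoid 0ℓ 0ℓ) : Set₁ where
  open Setoid S using (Carrier; _≈_)

  field
    Index  : Set
    Basic  : Index → Pred Carrier 0ℓ
    resp   : ∀ i → Basic i Respects _≈_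
    covers : ∀ x → ∃ λ i → x ∈ Basic i
    refine : ∀ i j {x} → x ∈ Basic i → x ∈ Basic j →
             ∃ λ k → x ∈ Basic k × Basic k ⊆ Basic i ∩ Basic j

  Interior : Pred Carrier ℓ → Pred Carrier ℓ
  Interior A x = ∃ λ i → x ∈ Basic i × Basic i ⊆ A

  Closure : Pred Carrier ℓ → Pred Carrier ℓ
  Closure A x = ∀ i → x ∈ Basic i → Basic i ≬ A

  Open : Pred Carrier ℓ → Set ℓ
  Open A = A ⊆ Interior A

  NowhereDense : Pred Carrier ℓ → Set ℓ
  NowhereDense A = Empty (Interior (Closure A))

  Meager : Pred Carrier ℓ → Set (lsuc 0ℓ ⊔ ℓ)
  Meager A = ∃ λ (N : ℕ → Pred Carrier 0ℓ) → (∀ n → NowhereDense (N n)) × A ⊆ ⋃ ℕ N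

record Space : Set₁ where
  field
    setoid   : Setoid 0ℓ 0ℓ
    topology : Topology setoid

  open Setoid setoid public
  open Topology topology public

infixr 2 _×ₜ_

_×ₜ_ : Space → Space → Space
X ×ₜ Y = record
  { setoid   = ×-setoid X.setoid Y.setoid
  ; topology = record
    { Index  = X.Index × Y.Index
    ; Basic  = λ (i , j) (x , y) → x ∈ X.Basic i × y ∈ Y.Basic j
    ; resp   = λ (i , j) (x≈x′ , y≈y′) (x∈ , y∈) → X.resp i x≈x′ x∈ , Y.resp j y≈y′ y∈
    ; covers = λ (x , y) →
        let (i , x∈i) = X.covers x
            (j , y∈j) = Y.covers y
        in (i , j) , x∈i , y∈j
    ; refine = λ (i , j) (i′ , j′) (x∈i , y∈j) (x∈i′ , y∈j′) →
        let (k , x∈k , k⊆) = X.refine i i′ x∈i x∈i′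
            (l , y∈l , l⊆) = Y.refine j j′ y∈j y∈j′
        in (k , l) , (x∈k , y∈l) , λ (x∈ , y∈) →
             (proj₁ (k⊆ x∈) , proj₁ (l⊆ y∈)) , (proj₂ (k⊆ x∈) , proj₂ (l⊆ y∈))
    }
  }
  where
  module X = Space X
  module Y = Space Y

Subspace : (X : Space) → Pred (Space.Carrier X) 0ℓ → Space
Subspace X P = record
  { setoid   = On.setoid {B = Σ X.Carrier P} X.setoid proj₁
  ; topology = record
    { Index  = X.Index
    ; Basic  = λ i → proj₁ ⊢ X.Basic i
    ; resp   = λ i → X.resp i
    ; covers = λ (x , _) → X.covers x
    ; refine = λ i j x∈i x∈j →
        let (k , x∈k , k⊆) = X.refine i j x∈i x∈j in k , x∈k , λ y∈k → k⊆ y∈k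
    }
  }
  where module X = Space X

Continuous : (X Y : Space) → (Space.Carrier X → Space.Carrier Y) → Set₁
Continuous X Y f = ∀ (O : Pred (Space.Carrier Y) 0ℓ) → Space.Open Y O → Space.Open X (f ⊢ O)

module _ (X Y : Space) where
  private
    module X = Space X
    module Y = Space Y

  record IsHomeomorphism (f : X.Carrier → Y.Carrier) : Set₁ where
    field
      continuous     : Continuous X Y f
      f⁻¹            : Y.Carrier → X.Carrier
      inverse        : Inverseᵇ X._≈_ Y._≈_ f f⁻¹
      f⁻¹-continuous : Continuous Y X f⁻¹

record TopologicalGroup : Set₁ where
  field
    group : Group 0ℓ 0ℓ

  open Group group public

  field
    topology : Topology setoid

  space : Space
  space = record { setoid = setoid ; topology = topology }

  field
    ∙-continuous  : Continuous (space ×ₜ space) space (λ (x , y) → x ∙ y)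
    ⁻¹-continuous : Continuous space space _⁻¹

module _ (K : TopologicalGroup) where
  open TopologicalGroup K

  data Generated (g₁ g₂ : Carrier) : Pred Carrier 0ℓ where
    gen₁  : g₁ ∈ Generated g₁ g₂
    gen₂  : g₂ ∈ Generated g₁ g₂
    unit  : ε ∈ Generated g₁ g₂
    mult  : ∀ {x y} → x ∈ Generated g₁ g₂ → y ∈ Generated g₁ g₂ → x ∙ y ∈ Generated g₁ g₂
    inv   : ∀ {x} → x ∈ Generated g₁ g₂ → x ⁻¹ ∈ Generated g₁ g₂
    resp≈ : ∀ {x y} → x ≈ y → x ∈ Generated g₁ g₂ → y ∈ Generated g₁ g₂

  generatedGroup : Carrier → Carrier → Group 0ℓ 0ℓ
  generatedGroup g₁ g₂ = record
    { Carrier = Σ Carrier (Generated g₁ g₂)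
    ; _≈_     = _≈_ on proj₁
    ; _∙_     = λ (x , x∈) (y , y∈) → x ∙ y , mult x∈ y∈
    ; ε       = ε , unit
    ; _⁻¹     = λ (x , x∈) → x ⁻¹ , inv x∈
    ; isGroup = record
      { isMonoid = record
        { isSemigroup = record
          { isMagma = record
            { isEquivalence = On.isEquivalence proj₁ isEquivalence
            ; ∙-cong        = ∙-cong
            }
          ; assoc = λ (x , _) (y , _) (z , _) → assoc x y z
          }
        ; identity = (λ (x , _) → identityˡ x) , (λ (x , _) → identityʳ x)
        }
      ; inverse = (λ (x , _) → inverseˡ x) , (λ (x , _) → inverseʳ x)
      ; ⁻¹-cong = ⁻¹-cong
      }
    }

  generatedSpace : Carrier → Carrier → Space
  generatedSpace g₁ g₂ = Subspace space (Generated g₁ g₂)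

  record TopologicallySimilar (g f : Carrier × Carrier) : Set₁ where
    private
      g₁ = proj₁ g
      g₂ = proj₂ g
      f₁ = proj₁ f
      f₂ = proj₂ f
      module ⟨g⟩ = Group (generatedGroup g₁ g₂)
      module ⟨f⟩ = Group (generatedGroup f₁ f₂)
    open GroupMorphisms ⟨g⟩.rawGroup ⟨f⟩.rawGroup
    field
      φ                  : ⟨g⟩.Carrier → ⟨f⟩.Carrier
      φ-g₁               : φ (g₁ , gen₁) ⟨f⟩.≈ (f₁ , gen₁)
      φ-g₂               : φ (g₂ , gen₂) ⟨f⟩.≈ (f₂ , gen₂)
      isGroupIsomorphism : IsGroupIsomorphism φ
      isHomeomorphism    : IsHomeomorphism (generatedSpace g₁ g₂) (generatedSpace f₁ f₂) φ

record Aut : Set where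
  field
    ⟦_⟧                : ℚ → ℚ
    isOrderIsomorphism : IsOrderIsomorphism _≡_ _≡_ _≤_ _≤_ ⟦_⟧

  open IsOrderIsomorphism isOrderIsomorphism public using (mono; cancel; injective; surjective)

  from : ℚ → ℚ
  from y = proj₁ (surjective y)

  to∘from : ∀ y → ⟦ from y ⟧ ≡ y
  to∘from y = proj₂ (surjective y) refl

  from∘to : ∀ x → from ⟦ x ⟧ ≡ x
  from∘to x = injective (to∘from ⟦ x ⟧)

open Aut using (⟦_⟧)

infix 4 _≈_

_≈_ : Rel Aut 0ℓ
f ≈ g = ∀ x → ⟦ f ⟧ x ≡ ⟦ g ⟧ x

idᵃ : Aut
idᵃ = record { isOrderIsomorphism = Identity.isOrderIsomorphism _≡_ _≤_ refl }

infixr 9 _∘ᵃ_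

_∘ᵃ_ : Aut → Aut → Aut
f ∘ᵃ g = record
  { isOrderIsomorphism =
      Composition.isOrderIsomorphism trans (Aut.isOrderIsomorphism g) (Aut.isOrderIsomorphism f)
  }

_⁻¹ᵃ : Aut → Aut
f ⁻¹ᵃ = record
  { ⟦_⟧ = f.from
  ; isOrderIsomorphism = record
    { isOrderMonomorphism = record
      { isOrderHomomorphism = record
        { cong = cong f.from
        ; mono = λ {x} {y} x≤y →
            f.cancel (subst₂ _≤_ (sym (f.to∘from x)) (sym (f.to∘from y)) x≤y)
        }
      ; injective = λ {x} {y} eq →
          trans (sym (f.to∘from x)) (trans (cong f.⟦_⟧ eq) (f.to∘from y))
      ; cancel = λ {x} {y} le → subst₂ _≤_ (f.to∘from x) (f.to∘from y) (f.mono le)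
      }
    ; surjective = λ x → f.⟦ x ⟧ , λ { refl → f.from∘to x }
    }
  }
  where module f = Aut f

Aut-group : Group 0ℓ 0ℓ
Aut-group = record
  { Carrier = Aut
  ; _≈_     = _≈_
  ; _∙_     = _∘ᵃ_
  ; ε       = idᵃ
  ; _⁻¹     = _⁻¹ᵃ
  ; isGroup = record
    { isMonoid = record
      { isSemigroup = record
        { isMagma = record
          { isEquivalence = record
            { refl  = λ _ → refl
            ; sym   = λ e x → sym (e x)
            ; trans = λ e e′ x → trans (e x) (e′ x)
            }
          ; ∙-cong = λ {f} {f′} {g} {g′} f≈f′ g≈g′ x →
              trans (cong ⟦ f ⟧ (g≈g′ x)) (f≈f′ (⟦ g′ ⟧ x))
          }
        ; assoc = λ _ _ _ _ → refl
        }
      ; identity = (λ _ _ → refl) , (λ _ _ → refl)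
      }
    ; inverse = (λ f x → Aut.from∘to f x) , (λ f x → Aut.to∘from f x)
    ; ⁻¹-cong = λ {f} {g} f≈g x →
        Aut.injective f (trans (Aut.to∘from f x)
          (sym (trans (f≈g (Aut.from g x)) (Aut.to∘from g x))))
    }
  }

-- An order-preserving bijection between finite subsets of ℚ, given by
-- listing its graph (order and repetitions in the list are irrelevant).
record FinitePartialIso : Set where
  field
    graph      : List (ℚ × ℚ)
    functional : ∀ {x y x′ y′} → (x , y) ∈ˡ graph → (x′ , y′) ∈ˡ graph → x ≡ x′ → y ≡ y′
    injective  : ∀ {x y x′ y′} → (x , y) ∈ˡ graph → (x′ , y′) ∈ˡ graph → y ≡ y′ → x ≡ x′
    monotone   : ∀ {x y x′ y′} → (x , y) ∈ˡ graph → (x′ , y′) ∈ˡ graph → x ≤ x′ → y ≤ y′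

open FinitePartialIso using (graph)

_⊇ᵍ_ : Aut → List (ℚ × ℚ) → Set
g ⊇ᵍ ps = All (λ (x , y) → ⟦ g ⟧ x ≡ y) ps

U : FinitePartialIso → Pred Aut 0ℓ
U p g = g ⊇ᵍ graph p

fromGraph : (g : Aut) (ps : List (ℚ × ℚ)) → g ⊇ᵍ ps → FinitePartialIso
fromGraph g ps g⊇ps = record
  { graph      = ps
  ; functional = λ xy∈ xy′∈ x≡x′ → trans (sym (at xy∈)) (trans (cong ⟦ g ⟧ x≡x′) (at xy′∈))
  ; injective  = λ xy∈ xy′∈ y≡y′ →
      Aut.injective g (trans (at xy∈) (trans y≡y′ (sym (at xy′∈))))
  ; monotone   = λ xy∈ xy′∈ x≤x′ → subst₂ _≤_ (at xy∈) (at xy′∈) (Aut.mono g x≤x′)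
  }
  where
  at : ∀ {x y} → (x , y) ∈ˡ ps → ⟦ g ⟧ x ≡ y
  at = All.lookup g⊇ps

U-resp : ∀ p → U p Respects _≈_
U-resp p f≈g = All.map λ {(x , _)} fx≡y → trans (sym (f≈g x)) fx≡y

Aut-topology : Topology (Group.setoid Aut-group)
Aut-topology = record
  { Index  = FinitePartialIso
  ; Basic  = U
  ; resp   = U-resp
  ; covers = λ g → fromGraph g [] [] , []
  ; refine = λ p q {g} g∈p g∈q →
      fromGraph g (graph p ++ graph q) (++⁺ g∈p g∈q) , ++⁺ g∈p g∈q ,
      λ h∈ → ++⁻ˡ (graph p) h∈ , ++⁻ʳ (graph p) h∈
  }

private
  -- If f ∘ g extends ps, then so does f′ ∘ g′ as soon as f′ and g′ extend
  -- these finite parts of f and g.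
  left right : Aut → List (ℚ × ℚ) → List (ℚ × ℚ)
  left  g = map λ (x , y) → ⟦ g ⟧ x , y
  right g = map λ (x , y) → x , ⟦ g ⟧ x

  left-⊇ : ∀ f g {ps} → (f ∘ᵃ g) ⊇ᵍ ps → f ⊇ᵍ left g ps
  left-⊇ f g []       = []
  left-⊇ f g (e ∷ es) = e ∷ left-⊇ f g es

  right-⊇ : ∀ g ps → g ⊇ᵍ right g ps
  right-⊇ g []       = []
  right-⊇ g (_ ∷ ps) = refl ∷ right-⊇ g ps

  ∘-⊇ : ∀ g f′ g′ ps → f′ ⊇ᵍ left g ps → g′ ⊇ᵍ right g ps → (f′ ∘ᵃ g′) ⊇ᵍ ps
  ∘-⊇ g f′ g′ []       []       []         = []
  ∘-⊇ g f′ g′ (_ ∷ ps) (e ∷ es) (e′ ∷ es′) =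
    trans (cong ⟦ f′ ⟧ e′) e ∷ ∘-⊇ g f′ g′ ps es es′

  flip : List (ℚ × ℚ) → List (ℚ × ℚ)
  flip = map λ (x , y) → y , x

  flip-⊇ : ∀ f {ps} → (f ⁻¹ᵃ) ⊇ᵍ ps → f ⊇ᵍ flip ps
  flip-⊇ f                   []       = []
  flip-⊇ f {(x , y) ∷ _} (e ∷ es) =
    trans (cong ⟦ f ⟧ (sym e)) (Aut.to∘from f x) ∷ flip-⊇ f es

  ⁻¹-⊇ : ∀ f ps → f ⊇ᵍ flip ps → (f ⁻¹ᵃ) ⊇ᵍ ps
  ⁻¹-⊇ f []             []       = []
  ⁻¹-⊇ f ((x , y) ∷ ps) (e ∷ es) =
    trans (cong (Aut.from f) (sym e)) (Aut.from∘to f y) ∷ ⁻¹-⊇ f ps es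

Aut-ℚ : TopologicalGroup
Aut-ℚ = record
  { group         = Aut-group
  ; topology      = Aut-topology
  ; ∙-continuous  = λ O O-open {(f , g)} fg∈O →
      let (p , fg∈p , p⊆O) = O-open fg∈O
          f⊇ = left-⊇ f g fg∈p
          g⊇ = right-⊇ g (graph p)
      in (fromGraph f _ f⊇ , fromGraph g _ g⊇) , (f⊇ , g⊇) ,
         λ {(f′ , g′)} (f′⊇ , g′⊇) → p⊆O (∘-⊇ g f′ g′ (graph p) f′⊇ g′⊇)
  ; ⁻¹-continuous = λ O O-open {f} f⁻¹∈O →
      let (p , f⁻¹∈p , p⊆O) = O-open f⁻¹∈O
          f⊇ = flip-⊇ f f⁻¹∈p
      in fromGraph f _ f⊇ , f⊇ , λ {f′} f′⊇ → p⊆O (⁻¹-⊇ f′ (graph p) f′⊇)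
  }

Aut-space : Space
Aut-space = TopologicalGroup.space Aut-ℚ

{-# OPTIONS --safe #-}

-- A pair is topologically similar to (f₁ , g₁) only if words fixing a large finite set
-- under one pair fix a prescribed finite set under the other.  Consider whether, under
-- (f₁ , g₁), every finite F and every power of f₁ admit a reduced word that begins with
-- that power and fixes F pointwise.
--
-- If so, then for a pair (f , g) with f x ≢ x the words fixing a suitable F under (f₁ , g₁)
-- must all fix x.  But the f-orbit of x leaves any finite set of prescribed values, and
-- beyond it the values along a reduced path may be chosen fresh, so some such word can
-- be made to move x by an arbitrarily small perturbation.
--
-- If not, then similar pairs share this obstruction for some finite set F′.  It can be
-- destroyed by replacing f and g with piecewise affine maps agreeing with them on a given
-- finite set: these commute near the ends of each orbital of the group they generate
-- (compare Brin and Squier), so a conjugate of a commutator by a word carrying F′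
-- close to the ends of orbitals fixes F′.

module Submission where

open import Defs
open import Algebra.Bundles using (Group)
open import Algebra.Morphism.Structures using (module GroupMorphisms)
open import Axiom.ExcludedMiddle using (ExcludedMiddle)
import Data.Integer.Base as ℤ
import Data.Integer.Properties as ℤ
open import Data.List.Base using (List; []; _∷_; _++_; map; replicate)
open import Data.List.Membership.Propositional using (_∈_; _∉_)
open import Data.List.Membership.Propositional.Properties using (∈-++⁺ʳ; ∈-++⁺ˡ; ∈-map⁺; ∈-++⁻; ∈-map⁻)
open import Data.List.Relation.Unary.All using ([]; _∷_)
open import Data.List.Relation.Unary.Any using (here; there)
open import Data.Nat.Base using (ℕ; zero; suc; z≤n; s≤s)
import Data.Nat.Base as ℕ
open import Data.Nat.Binary.Base using (ℕᵇ; zero; 2[1+_]; 1+[2_]; fromℕ; toℕ)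
open import Data.Nat.Binary.Properties using (fromℕ-toℕ)
import Data.Nat.Coprimality as Coprimality
import Data.Nat.Properties as ℕ
open import Data.Product.Base using (Σ; ∃; ∃₂; _×_; _,_; proj₁; proj₂)
open import Data.Rational.Base using (ℚ; mkℚ; 0ℚ; 1ℚ; _+_; _*_; _-_; -_; 1/_; _/_; _≤_; _<_; _>_; *≤*; positive; nonNegative; >-nonZero)
open import Data.Rational.Properties
open import Data.Rational.Solver using (module +-*-Solver)
import Data.Rational.Unnormalised.Base as ℚᵘ
import Data.Rational.Unnormalised.Properties as ℚᵘ
open import Data.Sum.Base using (_⊎_; inj₁; inj₂)
open import Level using (0ℓ)
open import Relation.Binary.Definitions using (Tri; tri<; tri≈; tri>)
open import Relation.Binary.PropositionalEquality using (_≡_; _≢_; refl; sym; trans; cong; cong₂; subst; subst₂)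
open import Relation.Nullary using (¬_; Dec; yes; no; contradiction)
open import Relation.Nullary.Decidable using (decidable-stable)
open import Relation.Unary using (Pred)

open +-*-Solver using (solve; _:=_; _:+_; _:*_; _:-_; :-_; con)
open Aut using (⟦_⟧; from; to∘from; from∘to)

-- Every power has to be available because the set `L` of prescribed points is given only later, and
-- the orbit of x may need any number of steps to leave it. Once it has left, the only prescribed
-- value at a newly reached point is that of the letter leading back, and a reduced path never uses
-- this letter.
--
-- Piecewise affine maps also get around the incompleteness of ℚ. Upward paths of arbitrary
-- automorphisms may accumulate at an irrational cut, which no fixed point in ℚ detects. For affine
-- maps with rational coefficients the displacement changes sign at a rational point, and where it
-- has one sign it is bounded away from zero on closed subintervals. So the orbitals between two
-- common fixed points have rational ends, and upward paths come arbitrarily close to the upper one.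
--
-- A single word has to bring all points of F′ near ends at once, so a later step may spoil an
-- earlier one. The induction therefore strengthens its goal beforehand: being near an end survives
-- any word fixed in advance, if "near" is chosen small enough.

-- Rational arithmetic and finite sets of rationals

p<q⇒0<q-p : ∀ {p q} → p < q → 0ℚ < q - p
p<q⇒0<q-p {p} {q} p<q = subst (_< q - p) (+-inverseʳ p) (+-monoˡ-< (- p) p<q)

p≤q⇒0≤q-p : ∀ {p q} → p ≤ q → 0ℚ ≤ q - p
p≤q⇒0≤q-p {p} {q} p≤q = subst (_≤ q - p) (+-inverseʳ p) (+-monoˡ-≤ (- p) p≤q)

p+[q-p]≡q : ∀ p q → p + (q - p) ≡ q
p+[q-p]≡q = solve 2 (λ p q → p :+ (q :- p) := q) refl

0<q⇒p<p+q : ∀ p {q} → 0ℚ < q → p < p + q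
0<q⇒p<p+q p {q} 0<q = subst (_< p + q) (+-identityʳ p) (+-monoʳ-< p 0<q)

0≤q⇒p≤p+q : ∀ p {q} → 0ℚ ≤ q → p ≤ p + q
0≤q⇒p≤p+q p {q} 0≤q = subst (_≤ p + q) (+-identityʳ p) (+-monoʳ-≤ p 0≤q)

0<q-p⇒p<q : ∀ {p q} → 0ℚ < q - p → p < q
0<q-p⇒p<q {p} {q} 0<q-p = subst (p <_) (p+[q-p]≡q p q) (0<q⇒p<p+q p 0<q-p)

0<p*q : ∀ {p q} → 0ℚ < p → 0ℚ < q → 0ℚ < p * q
0<p*q {p} {q} 0<p 0<q =
  positive⁻¹ (p * q) {{pos*pos⇒pos p {{positive 0<p}} q {{positive 0<q}}}}

0≤p*q : ∀ {p q} → 0ℚ ≤ p → 0ℚ ≤ q → 0ℚ ≤ p * q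
0≤p*q {p} {q} 0≤p 0≤q =
  nonNegative⁻¹ (p * q) {{nonNeg*nonNeg⇒nonNeg p {{nonNegative 0≤p}} q {{nonNegative 0≤q}}}}

<⇒≱ : ∀ {p q} → p < q → ¬ q ≤ p
<⇒≱ p<q q≤p = <-irrefl refl (<-≤-trans p<q q≤p)

recip : ∀ p → 0ℚ < p → ∃ λ r → 0ℚ < r × r * p ≡ 1ℚ
recip p 0<p = r , positive⁻¹ r {{1/pos⇒pos p {{positive 0<p}}}} , *-inverseˡ p {{>-nonZero 0<p}}
  where
  r = (1/ p) {{>-nonZero 0<p}}

bounds : ∀ (xs : List ℚ) → ∃₂ λ lo hi → lo < hi × (∀ {x} → x ∈ xs → lo < x × x < hi)
bounds []       = 0ℚ , 0ℚ + 1ℚ , 0<q⇒p<p+q 0ℚ (positive⁻¹ 1ℚ) , λ ()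
bounds (y ∷ xs) with bounds xs
... | lo , hi , lo<hi , within = lo′ , hi′ , <-trans lo′<y y<hi′ , λ
  { (here refl) → lo′<y , y<hi′
  ; (there x∈)  → ≤-<-trans lo′≤lo (proj₁ (within x∈)) , <-≤-trans (proj₂ (within x∈)) hi≤hi′
  }
  where
  smaller : ∃ λ l → l < y × l ≤ lo
  smaller with ≤-total y lo
  ... | inj₁ y≤lo = y - 1ℚ , y-1<y , ≤-trans (<⇒≤ y-1<y) y≤lo
    where
    y-1<y : y - 1ℚ < y
    y-1<y = 0<q-p⇒p<q (subst (0ℚ <_) (solve 1 (λ y → con 1ℚ := y :- (y :- con 1ℚ)) refl y) (positive⁻¹ 1ℚ))
  ... | inj₂ lo≤y = lo - 1ℚ , <-≤-trans lo-1<lo lo≤y , <⇒≤ lo-1<lo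
    where
    lo-1<lo : lo - 1ℚ < lo
    lo-1<lo = 0<q-p⇒p<q (subst (0ℚ <_) (solve 1 (λ y → con 1ℚ := y :- (y :- con 1ℚ)) refl lo) (positive⁻¹ 1ℚ))
  larger : ∃ λ h → y < h × hi ≤ h
  larger with ≤-total y hi
  ... | inj₁ y≤hi = hi + 1ℚ , ≤-<-trans y≤hi (0<q⇒p<p+q hi (positive⁻¹ 1ℚ)) , <⇒≤ (0<q⇒p<p+q hi (positive⁻¹ 1ℚ))
  ... | inj₂ hi≤y = y + 1ℚ , 0<q⇒p<p+q y (positive⁻¹ 1ℚ) , ≤-trans hi≤y (<⇒≤ (0<q⇒p<p+q y (positive⁻¹ 1ℚ)))
  lo′ = proj₁ smaller
  lo′<y = proj₁ (proj₂ smaller)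
  lo′≤lo = proj₂ (proj₂ smaller)
  hi′ = proj₁ larger
  y<hi′ = proj₁ (proj₂ larger)
  hi≤hi′ = proj₂ (proj₂ larger)

gapBelow : ∀ y (xs : List ℚ) → ∃ λ l → l < y × (∀ {x} → x ∈ xs → x < y → x ≤ l)
gapBelow y [] with bounds (y ∷ [])
... | lo , _ , _ , within = lo , proj₁ (within (here refl)) , λ ()
gapBelow y (x ∷ xs) with gapBelow y xs
... | l , l<y , below with l <? x | x <? y
... | yes l<x | yes x<y = x , x<y , λ
  { (here refl) _ → ≤-refl
  ; (there z∈) z<y → ≤-trans (below z∈ z<y) (<⇒≤ l<x) }
... | yes _ | no x≮y = l , l<y , λ
  { (here refl) x<y → contradiction x<y x≮y
  ; (there z∈) z<y → below z∈ z<y }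
... | no l≮x | _ = l , l<y , λ
  { (here refl) _ → ≮⇒≥ l≮x
  ; (there z∈) z<y → below z∈ z<y }

gapAbove : ∀ y (xs : List ℚ) → ∃ λ u → y < u × (∀ {x} → x ∈ xs → y < x → u ≤ x)
gapAbove y [] with bounds (y ∷ [])
... | _ , hi , _ , within = hi , proj₂ (within (here refl)) , λ ()
gapAbove y (x ∷ xs) with gapAbove y xs
... | u , y<u , above with x <? u | y <? x
... | yes x<u | yes y<x = x , y<x , λ
  { (here refl) _ → ≤-refl
  ; (there z∈) y<z → ≤-trans (<⇒≤ x<u) (above z∈ y<z) }
... | yes _ | no y≮x = u , y<u , λ
  { (here refl) y<x → contradiction y<x y≮x
  ; (there z∈) y<z → above z∈ y<z }
... | no x≮u | _ = u , y<u , λ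
  { (here refl) _ → ≮⇒≥ x≮u
  ; (there z∈) y<z → above z∈ y<z }

-- Automorphisms of ℚ

mono-< : ∀ (h : Aut) {x y} → x < y → ⟦ h ⟧ x < ⟦ h ⟧ y
mono-< h {x} {y} x<y = ≰⇒> λ hy≤hx → <⇒≱ x<y (Aut.cancel h hy≤hx)

cancel-< : ∀ (h : Aut) {x y} → ⟦ h ⟧ x < ⟦ h ⟧ y → x < y
cancel-< h hx<hy = ≰⇒> λ y≤x → <⇒≱ hx<hy (Aut.mono h y≤x)

fixed-from : ∀ (h : Aut) {x} → ⟦ h ⟧ x ≡ x → from h x ≡ x
fixed-from h {x} hx≡x = trans (cong (from h) (sym hx≡x)) (from∘to h x)

mkAut : (to fr : ℚ → ℚ) → (∀ {x y} → x < y → to x < to y) → (∀ y → to (fr y) ≡ y) → Aut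
mkAut to fr to-mono to∘fr = record
  { ⟦_⟧ = to
  ; isOrderIsomorphism = record
    { isOrderMonomorphism = record
      { isOrderHomomorphism = record { cong = cong to ; mono = mono }
      ; injective = λ eq → ≤-antisym (cancel (≤-reflexive eq)) (cancel (≤-reflexive (sym eq)))
      ; cancel = cancel
      }
    ; surjective = λ y → fr y , λ { refl → to∘fr y }
    }
  }
  where
  cancel : ∀ {x y} → to x ≤ to y → x ≤ y
  cancel tx≤ty = ≮⇒≥ λ y<x → <⇒≱ (to-mono y<x) tx≤ty
  mono : ∀ {x y} → x ≤ y → to x ≤ to y
  mono {x} {y} x≤y with x ≟ y
  ... | yes refl = ≤-refl
  ... | no x≢y   = <⇒≤ (to-mono (≰⇒> λ y≤x → x≢y (≤-antisym x≤y y≤x)))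

-- The base point s is arbitrary, so the same witness can be read at an endpoint or at a fixed
-- point, and it restricts to subintervals unchanged.
Affine : (ℚ → ℚ) → ℚ → ℚ → Set
Affine h a b = ∃ λ α → ∀ {s t} → a ≤ s → s ≤ b → a ≤ t → t ≤ b → h t ≡ h s + α * (t - s)

line : ∀ (a a′ α r : ℚ) → 0ℚ < α → r * α ≡ 1ℚ → Aut
line a a′ α r 0<α rα≡1 = mkAut (λ t → a′ + α * (t - a)) (λ y → a + r * (y - a′))
  (λ x<y → +-monoʳ-< a′ (*-monoʳ-<-pos α {{positive 0<α}} (+-monoˡ-< (- a) x<y)))
  λ y → trans (collect y) (trans (cong (λ u → a′ + u * (y - a′)) rα≡1)
          (trans (cong (a′ +_) (*-identityˡ (y - a′))) (p+[q-p]≡q a′ y)))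
  where
  collect : ∀ y → a′ + α * ((a + r * (y - a′)) - a) ≡ a′ + (r * α) * (y - a′)
  collect y = cong (a′ +_) (solve 4 (λ a α r v → α :* ((a :+ r :* v) :- a) := (r :* α) :* v) refl a α r (y - a′))

line-affine : ∀ a a′ α s t → a′ + α * (t - a) ≡ (a′ + α * (s - a)) + α * (t - s)
line-affine = solve 5 (λ a a′ α s t → a′ :+ α :* (t :- a) := (a′ :+ α :* (s :- a)) :+ α :* (t :- s)) refl

segment : ∀ {a b a′ b′} → a < b → a′ < b′ →
          ∃ λ (h : Aut) → ⟦ h ⟧ a ≡ a′ × ⟦ h ⟧ b ≡ b′ × Affine ⟦ h ⟧ a b
segment {a} {b} {a′} {b′} a<b a′<b′
  with recip (b - a) (p<q⇒0<q-p a<b) | recip (b′ - a′) (p<q⇒0<q-p a′<b′)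
... | r , 0<r , rd≡1 | r′ , _ , r′d′≡1 =
  line a a′ α (r′ * (b - a)) (0<p*q (p<q⇒0<q-p a′<b′) 0<r) αinv , ha , hb ,
  α , λ {s} {t} _ _ _ _ → line-affine a a′ α s t
  where
  α = (b′ - a′) * r
  regroup : ∀ r r′ d d′ → (r′ * d) * (d′ * r) ≡ (r * d) * (r′ * d′)
  regroup = solve 4 (λ r r′ d d′ → (r′ :* d) :* (d′ :* r) := (r :* d) :* (r′ :* d′)) refl
  αinv : (r′ * (b - a)) * α ≡ 1ℚ
  αinv = trans (regroup r r′ (b - a) (b′ - a′)) (cong₂ _*_ rd≡1 r′d′≡1)
  ha : a′ + α * (a - a) ≡ a′
  ha = trans (cong (λ u → a′ + α * u) (+-inverseʳ a)) (trans (cong (a′ +_) (*-zeroʳ α)) (+-identityʳ a′))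
  hb : a′ + α * (b - a) ≡ b′
  hb = trans (cong (a′ +_) (trans (*-assoc (b′ - a′) r (b - a))
         (trans (cong ((b′ - a′) *_) rd≡1) (*-identityʳ (b′ - a′))))) (p+[q-p]≡q a′ b′)

module Glue (h k : Aut) (a : ℚ) (ha≡ka : ⟦ h ⟧ a ≡ ⟦ k ⟧ a) where
  private
    to fr : ℚ → ℚ
    to t with t ≤? a
    ... | yes _ = ⟦ h ⟧ t
    ... | no  _ = ⟦ k ⟧ t
    fr y with y ≤? ⟦ h ⟧ a
    ... | yes _ = from h y
    ... | no  _ = from k y

    to-≤ : ∀ {t} → t ≤ a → to t ≡ ⟦ h ⟧ t
    to-≤ {t} t≤a with t ≤? a
    ... | yes _  = refl
    ... | no t≰a = contradiction t≤a t≰a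

    to-≥ : ∀ {t} → a ≤ t → to t ≡ ⟦ k ⟧ t
    to-≥ {t} a≤t with t ≤? a
    ... | yes t≤a = subst (λ s → ⟦ h ⟧ s ≡ ⟦ k ⟧ s) (≤-antisym a≤t t≤a) ha≡ka
    ... | no _    = refl

    to-mono : ∀ {x y} → x < y → to x < to y
    to-mono {x} {y} x<y with ≤-total x a | ≤-total y a
    ... | inj₁ x≤a | inj₁ y≤a = subst₂ _<_ (sym (to-≤ x≤a)) (sym (to-≤ y≤a)) (mono-< h x<y)
    ... | inj₂ a≤x | _ =
      subst₂ _<_ (sym (to-≥ a≤x)) (sym (to-≥ (≤-trans a≤x (<⇒≤ x<y)))) (mono-< k x<y)
    ... | inj₁ x≤a | inj₂ a≤y with x ≟ a
    ...   | yes refl = subst₂ _<_ (sym (to-≥ ≤-refl)) (sym (to-≥ a≤y)) (mono-< k x<y)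
    ...   | no x≢a   = subst₂ _<_ (sym (to-≤ x≤a)) (sym (to-≥ a≤y))
      (<-≤-trans (mono-< h (≰⇒> λ a≤x → x≢a (≤-antisym x≤a a≤x)))
                 (subst (_≤ ⟦ k ⟧ y) (sym ha≡ka) (Aut.mono k a≤y)))

    to∘fr : ∀ y → to (fr y) ≡ y
    to∘fr y with y ≤? ⟦ h ⟧ a
    ... | yes y≤ha = trans (to-≤ (Aut.cancel h (subst (_≤ ⟦ h ⟧ a) (sym (to∘from h y)) y≤ha))) (to∘from h y)
    ... | no y≰ha  = trans (to-≥ (Aut.cancel k (subst₂ _≤_ ha≡ka (sym (to∘from k y)) (<⇒≤ (≰⇒> y≰ha))))) (to∘from k y)

  abstract
    glue : Aut
    glue = mkAut to fr to-mono to∘fr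

    glue-≤ : ∀ {t} → t ≤ a → ⟦ glue ⟧ t ≡ ⟦ h ⟧ t
    glue-≤ = to-≤

    glue-≥ : ∀ {t} → a ≤ t → ⟦ glue ⟧ t ≡ ⟦ k ⟧ t
    glue-≥ = to-≥

open Glue

-- The graph is the broken line through (a, a), (y, y′) and (b, b), continued by the identity on
-- both sides.
bump : ∀ {a b y y′} → a < y → y < b → a < y′ → y′ < b →
       ∃ λ (h : Aut) → ⟦ h ⟧ y ≡ y′ × (∀ {t} → t ≤ a ⊎ b ≤ t → ⟦ h ⟧ t ≡ t)
bump {a} {b} {y} {y′} a<y y<b a<y′ y′<b =
  let (h₁ , h₁a , h₁y , _) = segment a<y a<y′
      (h₂ , h₂y , h₂b , _) = segment y<b y′<b
  in glued h₁ h₁a h₁y h₂ h₂y h₂b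
  where
  module _ (h₁ : Aut) (h₁a : ⟦ h₁ ⟧ a ≡ a) (h₁y : ⟦ h₁ ⟧ y ≡ y′)
           (h₂ : Aut) (h₂y : ⟦ h₂ ⟧ y ≡ y′) (h₂b : ⟦ h₂ ⟧ b ≡ b) where
    l : Aut
    l = glue h₂ idᵃ b h₂b
    h₁y≡ly : ⟦ h₁ ⟧ y ≡ ⟦ l ⟧ y
    h₁y≡ly = trans h₁y (trans (sym h₂y) (sym (glue-≤ h₂ idᵃ b h₂b (<⇒≤ y<b))))
    k : Aut
    k = glue h₁ l y h₁y≡ly
    a≡ka : a ≡ ⟦ k ⟧ a
    a≡ka = sym (trans (glue-≤ h₁ l y h₁y≡ly (<⇒≤ a<y)) h₁a)
    h : Aut
    h = glue idᵃ k a a≡ka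
    hy : ⟦ h ⟧ y ≡ y′
    hy = trans (glue-≥ idᵃ k a a≡ka (<⇒≤ a<y)) (trans (glue-≤ h₁ l y h₁y≡ly ≤-refl) h₁y)
    outside : ∀ {t} → t ≤ a ⊎ b ≤ t → ⟦ h ⟧ t ≡ t
    outside (inj₁ t≤a) = glue-≤ idᵃ k a a≡ka t≤a
    outside (inj₂ b≤t) = trans (glue-≥ idᵃ k a a≡ka (≤-trans (<⇒≤ (<-trans a<y y<b)) b≤t))
                        (trans (glue-≥ h₁ l y h₁y≡ly (≤-trans (<⇒≤ y<b) b≤t))
                               (glue-≥ h₂ idᵃ b h₂b b≤t))
    glued : ∃ λ (h : Aut) → ⟦ h ⟧ y ≡ y′ × (∀ {t} → t ≤ a ⊎ b ≤ t → ⟦ h ⟧ t ≡ t)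
    glued = h , hy , outside

-- Follow `f` by a bump around f z that is supported in a gap of the finite set f(D) ∪ E. By
-- injectivity f z is not in f(D), so the values on `D` survive. The new value lies strictly inside
-- the gap above f z, hence outside `E` even if f z is in `E`.
perturb : ∀ (f : Aut) D {z} → z ∉ D → ∀ E →
          ∃ λ (f′ : Aut) → (∀ {d} → d ∈ D → ⟦ f′ ⟧ d ≡ ⟦ f ⟧ d) × ⟦ f′ ⟧ z ∉ E
perturb f D {z} z∉D E =
  let (l , l<y , below)  = gapBelow y xs
      (u , y<u , above)  = gapAbove y xs
      (y′ , y<y′ , y′<u) = <-dense y<u
      (h , hy , outside) = bump l<y y<u (<-trans l<y y<y′) y′<u
  in h ∘ᵃ f , (λ d∈D → agree h outside below above d∈D (<-cmp _ y)) ,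
     λ hfz∈E → <⇒≱ y′<u (above (∈-++⁺ʳ _ (subst (_∈ E) hy hfz∈E)) y<y′)
  where
  y  = ⟦ f ⟧ z
  xs = map ⟦ f ⟧ D ++ E
  agree : ∀ h {l u} → (∀ {t} → t ≤ l ⊎ u ≤ t → ⟦ h ⟧ t ≡ t) →
          (∀ {x} → x ∈ xs → x < y → x ≤ l) → (∀ {x} → x ∈ xs → y < x → u ≤ x) →
          ∀ {d} → d ∈ D → Tri (⟦ f ⟧ d < y) (⟦ f ⟧ d ≡ y) (y < ⟦ f ⟧ d) →
          ⟦ h ⟧ (⟦ f ⟧ d) ≡ ⟦ f ⟧ d
  agree h outside below above d∈D (tri< fd<y _ _) = outside (inj₁ (below (∈-++⁺ˡ (∈-map⁺ ⟦ f ⟧ d∈D)) fd<y))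
  agree h outside below above d∈D (tri≈ _ fd≡y _) = contradiction (subst (_∈ D) (Aut.injective f fd≡y) d∈D) z∉D
  agree h outside below above d∈D (tri> _ _ y<fd) = outside (inj₂ (above (∈-++⁺ˡ (∈-map⁺ ⟦ f ⟧ d∈D)) y<fd))

-- Reduced words in two generators and their action

data Gen : Set where
  𝐟 𝐠 : Gen

data Letter : Set where
  pos neg : Gen → Letter

opp : Letter → Letter
opp (pos i) = neg i
opp (neg i) = pos i

-- The first letter of a word is the one applied first.
Word : Set
Word = List Letter

Pair : Set
Pair = Gen → Aut

act : Pair → Letter → Aut
act π (pos i) = π i
act π (neg i) = π i ⁻¹ᵃ

word : Pair → Word → Aut
word π []      = idᵃ
word π (ℓ ∷ w) = word π w ∘ᵃ act π ℓ

run : Pair → Word → ℚ → ℚ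
run π w = ⟦ word π w ⟧

run-++ : ∀ π v w x → run π (v ++ w) x ≡ run π w (run π v x)
run-++ π []      w x = refl
run-++ π (ℓ ∷ v) w x = run-++ π v w (⟦ act π ℓ ⟧ x)

act-opp : ∀ π ℓ x → ⟦ act π (opp ℓ) ⟧ (⟦ act π ℓ ⟧ x) ≡ x
act-opp π (pos i) x = from∘to (π i) x
act-opp π (neg i) x = to∘from (π i) x

-- Red p w q: the word p ∷ w is reduced and its last letter is q.
data Red (p : Letter) : Word → Letter → Set where
  []  : Red p [] p
  _∷_ : ∀ {ℓ w q} → ℓ ≢ opp p → Red ℓ w q → Red p (ℓ ∷ w) q

Red-++ : ∀ {p v q w r} → Red p v q → Red q w r → Red p (v ++ w) r
Red-++ []       s = s
Red-++ (ne ∷ r) s = ne ∷ Red-++ r s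

pos≢neg : ∀ {i j} → pos i ≢ neg j
pos≢neg ()

Red-replicate : ∀ n i → Red (pos i) (replicate n (pos i)) (pos i)
Red-replicate zero    i = []
Red-replicate (suc n) i = pos≢neg ∷ Red-replicate n i

-- Perturbing along a reduced path

-- D i lists the points at which the value of π i is prescribed.
Agree : (Gen → List ℚ) → Pair → Pair → Set
Agree D π π′ = ∀ i {d} → d ∈ D i → ⟦ π′ i ⟧ d ≡ ⟦ π i ⟧ d

-- Prescribing π i at d also prescribes its inverse at the image of d.
dom : Pair → (Gen → List ℚ) → Letter → List ℚ
dom π D (pos i) = D i
dom π D (neg i) = map ⟦ π i ⟧ (D i)

allDoms : Pair → (Gen → List ℚ) → List ℚ
allDoms π D = (dom π D (pos 𝐟) ++ dom π D (neg 𝐟)) ++ (dom π D (pos 𝐠) ++ dom π D (neg 𝐠))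

dom⊆allDoms : ∀ π D ℓ {x} → x ∈ dom π D ℓ → x ∈ allDoms π D
dom⊆allDoms π D (pos 𝐟) x∈ = ∈-++⁺ˡ (∈-++⁺ˡ x∈)
dom⊆allDoms π D (neg 𝐟) x∈ = ∈-++⁺ˡ (∈-++⁺ʳ (D 𝐟) x∈)
dom⊆allDoms π D (pos 𝐠) x∈ = ∈-++⁺ʳ (D 𝐟 ++ dom π D (neg 𝐟)) (∈-++⁺ˡ x∈)
dom⊆allDoms π D (neg 𝐠) x∈ = ∈-++⁺ʳ (D 𝐟 ++ dom π D (neg 𝐟)) (∈-++⁺ʳ (D 𝐠) x∈)

update : ∀ {A : Set} → (Gen → A) → Gen → A → Gen → A
update F 𝐟 u 𝐟 = u
update F 𝐟 u 𝐠 = F 𝐠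
update F 𝐠 u 𝐟 = F 𝐟
update F 𝐠 u 𝐠 = u

-- In `new∉D₁` the letter `opp ℓ` must be exempt, since it takes the new point back to z. The field
-- `fixed` protects the step from all later perturbations that respect `D₁`.
record Step (π : Pair) (D : Gen → List ℚ) (ℓ : Letter) (z : ℚ) (E : List ℚ) : Set where
  field
    π₁     : Pair
    D₁     : Gen → List ℚ
    agree  : Agree D π π₁
    D⊆D₁   : ∀ i {d} → d ∈ D i → d ∈ D₁ i
    new∉E  : ⟦ act π₁ ℓ ⟧ z ∉ E
    new∉D₁ : ∀ {ℓ′} → ℓ′ ≢ opp ℓ → ⟦ act π₁ ℓ ⟧ z ∉ dom π₁ D₁ ℓ′
    fixed  : ∀ {π₂} → Agree D₁ π₁ π₂ → ⟦ act π₂ ℓ ⟧ z ≡ ⟦ act π₁ ℓ ⟧ z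

step : ∀ π D ℓ {z} → z ∉ dom π D ℓ → ∀ E → Step π D ℓ z E
step π D (pos i) {z} z∉D E =
  -- The point z is avoided too: it becomes prescribed for `ℓ` itself, and `ℓ` may be the next
  -- letter.
  let (h , agree , hz∉) = perturb (π i) (D i) z∉D (E ++ z ∷ allDoms π D) in result i h agree hz∉
  where
  result : ∀ i h → (∀ {d} → d ∈ D i → ⟦ h ⟧ d ≡ ⟦ π i ⟧ d) →
           ⟦ h ⟧ z ∉ E ++ z ∷ allDoms π D → Step π D (pos i) z E
  result 𝐟 h agree hz∉ = record
    { π₁ = update π 𝐟 h
    ; D₁ = update D 𝐟 (z ∷ D 𝐟)
    ; agree  = λ { 𝐟 → agree ; 𝐠 _ → refl }
    ; D⊆D₁   = λ { 𝐟 → there ; 𝐠 d∈ → d∈ }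
    ; new∉E  = λ ∈E → hz∉ (∈-++⁺ˡ ∈E)
    ; new∉D₁ = λ
      { {pos 𝐟} _ (here eq)  → hz∉ (∈-++⁺ʳ E (here eq))
      ; {pos 𝐟} _ (there ∈D) → hz∉ (∈-++⁺ʳ E (there (dom⊆allDoms π D (pos 𝐟) ∈D)))
      ; {neg 𝐟} ne _         → ne refl
      ; {pos 𝐠} _ ∈D         → hz∉ (∈-++⁺ʳ E (there (dom⊆allDoms π D (pos 𝐠) ∈D)))
      ; {neg 𝐠} _ ∈D         → hz∉ (∈-++⁺ʳ E (there (dom⊆allDoms π D (neg 𝐠) ∈D)))
      }
    ; fixed  = λ agree₂ → agree₂ 𝐟 (here refl)
    }
  result 𝐠 h agree hz∉ = record
    { π₁ = update π 𝐠 h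
    ; D₁ = update D 𝐠 (z ∷ D 𝐠)
    ; agree  = λ { 𝐠 → agree ; 𝐟 _ → refl }
    ; D⊆D₁   = λ { 𝐠 → there ; 𝐟 d∈ → d∈ }
    ; new∉E  = λ ∈E → hz∉ (∈-++⁺ˡ ∈E)
    ; new∉D₁ = λ
      { {pos 𝐠} _ (here eq)  → hz∉ (∈-++⁺ʳ E (here eq))
      ; {pos 𝐠} _ (there ∈D) → hz∉ (∈-++⁺ʳ E (there (dom⊆allDoms π D (pos 𝐠) ∈D)))
      ; {neg 𝐠} ne _         → ne refl
      ; {pos 𝐟} _ ∈D         → hz∉ (∈-++⁺ʳ E (there (dom⊆allDoms π D (pos 𝐟) ∈D)))
      ; {neg 𝐟} _ ∈D         → hz∉ (∈-++⁺ʳ E (there (dom⊆allDoms π D (neg 𝐟) ∈D)))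
      }
    ; fixed  = λ agree₂ → agree₂ 𝐠 (here refl)
    }
step π D (neg i) {z} z∉D E =
  -- Here the inverse is perturbed, to k. The new generator is the inverse of k, and its newly
  -- prescribed point is `⟦ k ⟧ z`, with value z.
  let (k , agree , kz∉) = perturb (π i ⁻¹ᵃ) (map ⟦ π i ⟧ (D i)) z∉D (E ++ z ∷ allDoms π D)
  in result i k (λ {d} d∈ → trans (cong (from k) (sym (trans (agree (∈-map⁺ ⟦ π i ⟧ d∈)) (from∘to (π i) d)))) (from∘to k (⟦ π i ⟧ d))) kz∉
  where
  fixed-neg : ∀ (h k : Aut) → ⟦ h ⟧ (⟦ k ⟧ z) ≡ from k (⟦ k ⟧ z) → from h z ≡ ⟦ k ⟧ z
  fixed-neg h k eq = trans (cong (from h) (sym (trans eq (from∘to k z)))) (from∘to h (⟦ k ⟧ z))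
  image : ∀ (h k : Aut) {xs} → (∀ {d} → d ∈ xs → from k d ≡ ⟦ h ⟧ d) →
          ∀ {x} → x ∈ map (from k) (⟦ k ⟧ z ∷ xs) → x ∈ z ∷ map ⟦ h ⟧ xs
  image h k agree (here eq) = here (trans eq (from∘to k z))
  image h k agree (there x∈) with ∈-map⁻ (from k) x∈
  ... | d , d∈ , refl = there (subst (_∈ _) (sym (agree d∈)) (∈-map⁺ ⟦ h ⟧ d∈))
  result : ∀ i k → (∀ {d} → d ∈ D i → from k d ≡ ⟦ π i ⟧ d) →
           ⟦ k ⟧ z ∉ E ++ z ∷ allDoms π D → Step π D (neg i) z E
  result 𝐟 k agree kz∉ = record
    { π₁ = update π 𝐟 (k ⁻¹ᵃ)
    ; D₁ = update D 𝐟 (⟦ k ⟧ z ∷ D 𝐟)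
    ; agree  = λ { 𝐟 → agree ; 𝐠 _ → refl }
    ; D⊆D₁   = λ { 𝐟 → there ; 𝐠 d∈ → d∈ }
    ; new∉E  = λ ∈E → kz∉ (∈-++⁺ˡ ∈E)
    ; new∉D₁ = λ
      { {neg 𝐟} _ ∈D → old (image (π 𝐟) k agree ∈D)
      ; {pos 𝐟} ne _ → ne refl
      ; {pos 𝐠} _ ∈D → kz∉ (∈-++⁺ʳ E (there (dom⊆allDoms π D (pos 𝐠) ∈D)))
      ; {neg 𝐠} _ ∈D → kz∉ (∈-++⁺ʳ E (there (dom⊆allDoms π D (neg 𝐠) ∈D)))
      }
    ; fixed  = λ {π₂} agree₂ → fixed-neg (π₂ 𝐟) k (agree₂ 𝐟 (here refl))
    }
    where
    old : ⟦ k ⟧ z ∉ z ∷ map ⟦ π 𝐟 ⟧ (D 𝐟)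
    old (here eq)  = kz∉ (∈-++⁺ʳ E (here eq))
    old (there ∈D) = kz∉ (∈-++⁺ʳ E (there (dom⊆allDoms π D (neg 𝐟) ∈D)))
  result 𝐠 k agree kz∉ = record
    { π₁ = update π 𝐠 (k ⁻¹ᵃ)
    ; D₁ = update D 𝐠 (⟦ k ⟧ z ∷ D 𝐠)
    ; agree  = λ { 𝐠 → agree ; 𝐟 _ → refl }
    ; D⊆D₁   = λ { 𝐠 → there ; 𝐟 d∈ → d∈ }
    ; new∉E  = λ ∈E → kz∉ (∈-++⁺ˡ ∈E)
    ; new∉D₁ = λ
      { {neg 𝐠} _ ∈D → old (image (π 𝐠) k agree ∈D)
      ; {pos 𝐠} ne _ → ne refl
      ; {pos 𝐟} _ ∈D → kz∉ (∈-++⁺ʳ E (there (dom⊆allDoms π D (pos 𝐟) ∈D)))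
      ; {neg 𝐟} _ ∈D → kz∉ (∈-++⁺ʳ E (there (dom⊆allDoms π D (neg 𝐟) ∈D)))
      }
    ; fixed  = λ {π₂} agree₂ → fixed-neg (π₂ 𝐠) k (agree₂ 𝐠 (here refl))
    }
    where
    old : ⟦ k ⟧ z ∉ z ∷ map ⟦ π 𝐠 ⟧ (D 𝐠)
    old (here eq)  = kz∉ (∈-++⁺ʳ E (here eq))
    old (there ∈D) = kz∉ (∈-++⁺ʳ E (there (dom⊆allDoms π D (neg 𝐠) ∈D)))

-- Along a reduced path that has left the prescribed points, only the inverse of the
-- letter just used has a prescribed value at the current point.
fresh : ∀ {p w q} → Red p w q → ∀ π D {z} E → (∀ {ℓ} → ℓ ≢ opp p → z ∉ dom π D ℓ) → z ∉ E →
        ∃ λ π′ → Agree D π π′ × run π′ w z ∉ E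
fresh []       π D E z∉D z∉E = π , (λ _ _ → refl) , z∉E
fresh (_∷_ {ℓ} {w} ℓ≢ r) π D {z} E z∉D z∉E =
  let (π₂ , agree₂ , ∉E) = fresh r S.π₁ S.D₁ E S.new∉D₁ S.new∉E
  in π₂ , (λ i d∈ → trans (agree₂ i (S.D⊆D₁ i d∈)) (S.agree i d∈)) ,
     subst (λ u → run π₂ w u ∉ E) (sym (S.fixed agree₂)) ∉E
  where module S = Step (step π D ℓ (z∉D ℓ≢) E)

-- Orbits of one generator

-- The order is a parameter so that increasing and decreasing orbits are treated at once.
module Orbit (f : ℚ → ℚ) (_⊏_ : ℚ → ℚ → Set) (⊏-trans : ∀ {x y z} → x ⊏ y → y ⊏ z → x ⊏ z)
             (⊏-irrefl : ∀ {x} → ¬ x ⊏ x) (f-mono : ∀ {x y} → x ⊏ y → f x ⊏ f y) where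

  iter : ℕ → ℚ → ℚ
  iter zero    x = x
  iter (suc n) x = iter n (f x)

  orbit : ℕ → ℚ → List ℚ
  orbit zero    x = []
  orbit (suc n) x = x ∷ orbit n (f x)

  iter-increasing : ∀ {x} → x ⊏ f x → ∀ {m n} → m ℕ.< n → iter m x ⊏ iter n x
  iter-increasing x⊏ {zero}  {suc zero}    _ = x⊏
  iter-increasing x⊏ {zero}  {suc (suc n)} _ = ⊏-trans x⊏ (iter-increasing (f-mono x⊏) {zero} {suc n} (s≤s z≤n))
  iter-increasing x⊏ {suc m} {suc n} (s≤s m<n) = iter-increasing (f-mono x⊏) m<n

  orbit-below : ∀ {x} → x ⊏ f x → ∀ n {y} → y ∈ orbit n x → y ⊏ iter n x
  orbit-below x⊏ (suc n) (here refl) = iter-increasing x⊏ {zero} {suc n} (s≤s z≤n)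
  orbit-below x⊏ (suc n) (there y∈)  = orbit-below (f-mono x⊏) n y∈

  -- A strictly monotone orbit meets each entry of `M` at most once, so it suffices to go beyond the
  -- last meeting.
  leaves : ExcludedMiddle 0ℓ → ∀ {x} → x ⊏ f x → ∀ (M : List ℚ) → ∃ λ n₀ → ∀ {n} → n₀ ℕ.≤ n → iter n x ∉ M
  leaves em x⊏ []      = 0 , λ _ ()
  leaves em {x} x⊏ (m ∷ M) with leaves em x⊏ M | em {∃ λ k → iter k x ≡ m}
  ... | n₀ , leave | no never = n₀ , λ
    { {n} _ (here eq) → never (n , eq)
    ; n₀≤n (there ∈M) → leave n₀≤n ∈M }
  ... | n₀ , leave | yes (k , refl) = n₀ ℕ.⊔ suc k , λ
    { {n} le (here eq)  → ⊏-irrefl (subst (iter k x ⊏_) eq (iter-increasing x⊏ (ℕ.≤-trans (ℕ.m≤n⊔m n₀ (suc k)) le)))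
    ; le (there ∈M) → leave (ℕ.≤-trans (ℕ.m≤m⊔n n₀ (suc k)) le) ∈M }

-- The f-orbit of x leaves any finite set, and from there on the reduced
-- continuation w can be steered away from x.
moveOff : ExcludedMiddle 0ℓ → ∀ (K : Word → Set) →
  (∀ N → ∃₂ λ w q → Red (pos 𝐟) w q × K (replicate (suc N) (pos 𝐟) ++ w)) →
  ∀ π L {x} → ⟦ π 𝐟 ⟧ x ≢ x →
  ∃₂ λ π′ w → Agree (λ _ → L) π π′ × K w × run π′ w x ≢ x
moveOff em K continue π L {x} fx≢x = cases (<-cmp x (⟦ π 𝐟 ⟧ x))
  where
  module Along (_⊏_ : ℚ → ℚ → Set) (⊏-trans : ∀ {x y z} → x ⊏ y → y ⊏ z → x ⊏ z)
               (⊏-irrefl : ∀ {x} → ¬ x ⊏ x) (f-mono : ∀ {x y} → x ⊏ y → ⟦ π 𝐟 ⟧ x ⊏ ⟦ π 𝐟 ⟧ y)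
               (x⊏fx : x ⊏ ⟦ π 𝐟 ⟧ x) where
    open Orbit ⟦ π 𝐟 ⟧ _⊏_ ⊏-trans ⊏-irrefl f-mono

    run-power : ∀ {π′ D} → Agree D π π′ → ∀ n y → (∀ {d} → d ∈ orbit n y → d ∈ D 𝐟) →
                run π′ (replicate n (pos 𝐟)) y ≡ iter n y
    run-power agree zero    y ⊆D = refl
    run-power {π′} agree (suc n) y ⊆D =
      trans (cong (run π′ (replicate n (pos 𝐟))) (agree 𝐟 (⊆D (here refl))))
            (run-power agree n (⟦ π 𝐟 ⟧ y) (λ d∈ → ⊆D (there d∈)))

    moved : ∀ N → iter (suc N) x ∉ L ++ map ⟦ π 𝐠 ⟧ L →
            ∃₂ λ π′ w → Agree (λ _ → L) π π′ × K w × run π′ w x ≢ x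
    moved N z∉ =
      let (w , q , red , kw)  = continue N
          (π′ , agree , z∉x) = fresh red π D (x ∷ []) (λ {ℓ} → z∉D {ℓ})
                                 λ { (here eq) → ⊏-irrefl (subst (_⊏ z) (sym eq) (iter-increasing x⊏fx {0} {suc N} (s≤s z≤n))) }
      in π′ , replicate (suc N) (pos 𝐟) ++ w ,
         (λ { 𝐟 d∈ → agree 𝐟 (∈-++⁺ˡ d∈) ; 𝐠 d∈ → agree 𝐠 d∈ }) , kw ,
         λ eq → z∉x (here (trans (cong (run π′ w) (sym (run-power agree (suc N) x (∈-++⁺ʳ L))))
                          (trans (sym (run-++ π′ (replicate (suc N) (pos 𝐟)) w x)) eq)))
      where
      z = iter (suc N) x
      -- Prescribing the orbit as well keeps the run through the initial power unchanged while the
      -- values along `w` are altered.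
      D : Gen → List ℚ
      D 𝐟 = L ++ orbit (suc N) x
      D 𝐠 = L
      z∉D : ∀ {ℓ} → ℓ ≢ neg 𝐟 → z ∉ dom π D ℓ
      z∉D {pos 𝐟} _ z∈ with ∈-++⁻ L z∈
      ... | inj₁ z∈L = z∉ (∈-++⁺ˡ z∈L)
      ... | inj₂ z∈o = ⊏-irrefl (orbit-below x⊏fx (suc N) z∈o)
      z∉D {neg 𝐟} ne _  = ne refl
      z∉D {pos 𝐠} _ z∈ = z∉ (∈-++⁺ˡ z∈)
      z∉D {neg 𝐠} _ z∈ = z∉ (∈-++⁺ʳ L z∈)

    result : ∃₂ λ π′ w → Agree (λ _ → L) π π′ × K w × run π′ w x ≢ x
    -- The image of `L` under f does not occur here, because after the power of `𝐟` a reduced word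
    -- does not continue with `neg 𝐟`.
    result = let (N , leave) = leaves em x⊏fx (L ++ map ⟦ π 𝐠 ⟧ L) in moved N (leave (ℕ.n≤1+n N))

  cases : Tri (x < ⟦ π 𝐟 ⟧ x) (x ≡ ⟦ π 𝐟 ⟧ x) (⟦ π 𝐟 ⟧ x < x) →
          ∃₂ λ π′ w → Agree (λ _ → L) π π′ × K w × run π′ w x ≢ x
  cases (tri< x<fx _ _) = Along.result _<_ <-trans (<-irrefl refl) (mono-< (π 𝐟)) x<fx
  cases (tri≈ _ eq _)   = contradiction (sym eq) fx≢x
  cases (tri> _ _ fx<x) = Along.result _>_ (λ p q → <-trans q p) (<-irrefl refl) (mono-< (π 𝐟)) fx<x

-- Affine functions on an interval

affine-displacement : ∀ {f a b} → Affine f a b → Affine (λ t → f t - t) a b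
affine-displacement {f} (α , aff) = α - 1ℚ , λ {s} {t} a≤s s≤b a≤t t≤b →
  trans (cong (_- t) (aff a≤s s≤b a≤t t≤b))
        (solve 4 (λ F α s t → (F :+ α :* (t :- s)) :- t := (F :- s) :+ (α :- con 1ℚ) :* (t :- s)) refl (f s) α s t)

affine-neg : ∀ {φ a b} → Affine φ a b → Affine (λ t → - φ t) a b
affine-neg {φ} (α , aff) = - α , λ {s} {t} a≤s s≤b a≤t t≤b →
  trans (cong -_ (aff a≤s s≤b a≤t t≤b))
        (solve 3 (λ F α u → :- (F :+ α :* u) := :- F :+ (:- α) :* u) refl (φ s) α (t - s))

affine-shift : ∀ {φ a b} m → Affine φ a b → Affine (λ t → φ t - m) a b
affine-shift {φ} m (α , aff) = α , λ {s} {t} a≤s s≤b a≤t t≤b →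
  trans (cong (_- m) (aff a≤s s≤b a≤t t≤b))
        (solve 3 (λ F m u → (F :+ u) :- m := (F :- m) :+ u) refl (φ s) m (α * (t - s)))

-- The value inside is a weighted mean of the values at the ends. The denominator is cleared, so
-- that signs pass from the ends to the inside without division.
affine-convex : ∀ {φ a b t} → Affine φ a b → a ≤ t → t ≤ b →
                (b - a) * φ t ≡ (b - t) * φ a + (t - a) * φ b
affine-convex {φ} {a} {b} {t} (α , aff) a≤t t≤b =
  trans (solve 5 (λ a b t α F → (b :- a) :* F :=
                   (b :- t) :* (F :+ α :* (a :- t)) :+ (t :- a) :* (F :+ α :* (b :- t))) refl a b t α (φ t))
        (sym (cong₂ (λ u v → (b - t) * u + (t - a) * v)
          (aff a≤t t≤b ≤-refl (≤-trans a≤t t≤b)) (aff a≤t t≤b (≤-trans a≤t t≤b) ≤-refl)))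

cancel-0< : ∀ {p q} → 0ℚ < p → 0ℚ < p * q → 0ℚ < q
cancel-0< {p} {q} 0<p 0<pq =
  *-cancelˡ-<-nonNeg p {{nonNegative (<⇒≤ 0<p)}} (subst (_< p * q) (sym (*-zeroʳ p)) 0<pq)

cancel-0≤ : ∀ {p q} → 0ℚ < p → 0ℚ ≤ p * q → 0ℚ ≤ q
cancel-0≤ {p} {q} 0<p 0≤pq =
  *-cancelˡ-≤-pos p {{positive 0<p}} (subst (_≤ p * q) (sym (*-zeroʳ p)) 0≤pq)

affine-nonneg : ∀ {φ a b t} → a < b → Affine φ a b → 0ℚ ≤ φ a → 0ℚ ≤ φ b → a ≤ t → t ≤ b → 0ℚ ≤ φ t
affine-nonneg a<b aff 0≤φa 0≤φb a≤t t≤b =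
  cancel-0≤ (p<q⇒0<q-p a<b) (subst (0ℚ ≤_) (sym (affine-convex aff a≤t t≤b))
    (+-mono-≤ (0≤p*q (p≤q⇒0≤q-p t≤b) 0≤φa) (0≤p*q (p≤q⇒0≤q-p a≤t) 0≤φb)))

affine-pos : ∀ {φ a b t} → Affine φ a b → 0ℚ ≤ φ a → 0ℚ ≤ φ b → 0ℚ < φ a ⊎ 0ℚ < φ b →
             a < t → t < b → 0ℚ < φ t
affine-pos {φ} {a} {b} {t} aff 0≤φa 0≤φb strict a<t t<b =
  cancel-0< (p<q⇒0<q-p (<-trans a<t t<b))
    (subst (0ℚ <_) (sym (affine-convex aff (<⇒≤ a<t) (<⇒≤ t<b))) (sum strict))
  where
  0<b-t = p<q⇒0<q-p t<b
  0<t-a = p<q⇒0<q-p a<t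
  sum : 0ℚ < φ a ⊎ 0ℚ < φ b → 0ℚ < (b - t) * φ a + (t - a) * φ b
  sum (inj₁ 0<φa) = +-mono-<-≤ (0<p*q 0<b-t 0<φa) (0≤p*q (<⇒≤ 0<t-a) 0≤φb)
  sum (inj₂ 0<φb) = +-mono-≤-< (0≤p*q (<⇒≤ 0<b-t) 0≤φa) (0<p*q 0<t-a 0<φb)

affine-zero : ∀ {φ a b t} → a < b → Affine φ a b → φ a ≡ 0ℚ → φ b ≡ 0ℚ → a ≤ t → t ≤ b → φ t ≡ 0ℚ
affine-zero {φ} {a} {b} {t} a<b aff φa φb a≤t t≤b = ≤-antisym
  (subst (_≤ 0ℚ) (neg-neg (φ t)) (neg-antimono-≤
    (affine-nonneg a<b (affine-neg aff) (≤-reflexive (cong -_ (sym φa))) (≤-reflexive (cong -_ (sym φb))) a≤t t≤b)))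
  (affine-nonneg a<b aff (≤-reflexive (sym φa)) (≤-reflexive (sym φb)) a≤t t≤b)
  where
  neg-neg : ∀ p → - (- p) ≡ p
  neg-neg = solve 1 (λ p → :- (:- p) := p) refl

-- This t divides the interval in the ratio A : B, which is where an affine function with values -A
-- and B at the ends vanishes.
weighted : ∀ {a b A B} → a < b → 0ℚ < A → 0ℚ < B →
           ∃ λ t → a < t × t < b × (t - a) * B ≡ (b - t) * A
weighted {a} {b} {A} {B} a<b 0<A 0<B =
  let (r , 0<r , r[A+B]≡1) = recip (A + B) (+-mono-< 0<A 0<B) in found r 0<r r[A+B]≡1
  where
  p = b - a
  0<p = p<q⇒0<q-p a<b
  module _ (r : ℚ) (0<r : 0ℚ < r) (inverse : r * (A + B) ≡ 1ℚ) where
    t = a + p * (A * r)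
    t-a : t - a ≡ p * (A * r)
    t-a = solve 2 (λ a u → (a :+ u) :- a := u) refl a (p * (A * r))
    b-t : b - t ≡ p * (B * r)
    b-t = trans (solve 3 (λ a b u → b :- (a :+ u) := (b :- a) :* con 1ℚ :- u) refl a b (p * (A * r)))
         (trans (cong (λ v → p * v - p * (A * r)) (sym inverse))
                (solve 4 (λ p A B r → p :* (r :* (A :+ B)) :- p :* (A :* r) := p :* (B :* r)) refl p A B r))
    found : ∃ λ t → a < t × t < b × (t - a) * B ≡ (b - t) * A
    found = t , 0<q⇒p<p+q a (0<p*q 0<p (0<p*q 0<A 0<r)) ,
      0<q-p⇒p<q (subst (0ℚ <_) (sym b-t) (0<p*q 0<p (0<p*q 0<B 0<r))) ,
      trans (cong (_* B) t-a) (trans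
        (solve 4 (λ p A B r → p :* (A :* r) :* B := p :* (B :* r) :* A) refl p A B r)
        (cong (_* A) (sym b-t)))

affine-root : ∀ {φ a b} → a < b → Affine φ a b → 0ℚ < - φ a → 0ℚ < φ b →
              ∃ λ t → a < t × t < b × φ t ≡ 0ℚ
affine-root {φ} {a} {b} a<b aff φa<0 0<φb =
  let (t , a<t , t<b , eq) = weighted a<b φa<0 0<φb
  in t , a<t , t<b , root t a<t t<b eq
  where
  root : ∀ t → a < t → t < b → (t - a) * φ b ≡ (b - t) * - φ a → φ t ≡ 0ℚ
  root t a<t t<b eq = *-cancelˡ-0 (trans (affine-convex aff (<⇒≤ a<t) (<⇒≤ t<b))
    (trans (cong (λ u → (b - t) * φ a + u) eq)
           (solve 2 (λ u v → u :* v :+ u :* (:- v) := con 0ℚ) refl (b - t) (φ a))))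
    where
    *-cancelˡ-0 : (b - a) * φ t ≡ 0ℚ → φ t ≡ 0ℚ
    *-cancelˡ-0 e = let (r , _ , rp≡1) = recip (b - a) (p<q⇒0<q-p a<b) in
      trans (sym (*-identityˡ (φ t))) (trans (cong (_* φ t) (sym rp≡1))
        (trans (*-assoc r (b - a) (φ t)) (trans (cong (r *_) e) (*-zeroʳ r))))

-- An affine function is smallest at an end. This takes the place of compactness, which ℚ lacks: a
-- displacement bounded below lets iterates pass a given point in finitely many steps.
affine-bounded : ∀ {φ a b} → a < b → Affine φ a b → 0ℚ < φ a → 0ℚ < φ b →
                 ∃ λ δ → 0ℚ < δ × (∀ {t} → a ≤ t → t ≤ b → δ ≤ φ t)
affine-bounded {φ} {a} {b} a<b aff 0<φa 0<φb = pick (≤-total (φ a) (φ b))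
  where
  0≤q-p⇒p≤q : ∀ {p q} → 0ℚ ≤ q - p → p ≤ q
  0≤q-p⇒p≤q {p} {q} le = subst (p ≤_) (p+[q-p]≡q p q) (0≤q⇒p≤p+q p le)
  above : ∀ δ → δ ≤ φ a → δ ≤ φ b → ∀ {t} → a ≤ t → t ≤ b → δ ≤ φ t
  above δ δ≤φa δ≤φb a≤t t≤b = 0≤q-p⇒p≤q
    (affine-nonneg a<b (affine-shift δ aff) (p≤q⇒0≤q-p δ≤φa) (p≤q⇒0≤q-p δ≤φb) a≤t t≤b)
  pick : φ a ≤ φ b ⊎ φ b ≤ φ a → ∃ λ δ → 0ℚ < δ × (∀ {t} → a ≤ t → t ≤ b → δ ≤ φ t)
  pick (inj₁ φa≤φb) = φ a , 0<φa , above (φ a) ≤-refl φa≤φb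
  pick (inj₂ φb≤φa) = φ b , 0<φb , above (φ b) φb≤φa ≤-refl

infixl 7 _·_
_·_ : ℕ → ℚ → ℚ
zero  · δ = 0ℚ
suc n · δ = δ + n · δ

archimedean : ∀ {δ} r → 0ℚ < δ → ∃ λ n → r ≤ n · δ
archimedean {δ} r 0<δ =
  let (ρ , _ , ρδ≡1) = recip δ 0<δ
      (n , rρ≤n)     = natural (r * ρ)
  in n , subst₂ _≤_
       (trans (*-assoc r ρ δ) (trans (cong (r *_) ρδ≡1) (*-identityʳ r)))
       (scale n)
       (*-monoʳ-≤-nonNeg δ {{nonNegative (<⇒≤ 0<δ)}} rρ≤n)
  where
  scale : ∀ n → (n · 1ℚ) * δ ≡ n · δ
  scale zero    = *-zeroˡ δ
  scale (suc n) = trans (*-distribʳ-+ δ 1ℚ (n · 1ℚ)) (cong₂ _+_ (*-identityˡ δ) (scale n))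
  ι : ℕ → ℚ
  ι n = mkℚ (ℤ.+ n) 0 (Coprimality.sym (Coprimality.1-coprimeTo n))
  ι≡· : ∀ n → ι n ≡ n · 1ℚ
  ι≡· zero    = refl
  ι≡· (suc n) = trans (toℚᵘ-injective (ℚᵘ.≃-sym (ℚᵘ.≃-trans (toℚᵘ-homo-+ 1ℚ (ι n)) (ℚᵘ.*≡* eq))))
                      (cong (λ q → 1ℚ + q) (ι≡· n))
    where
    eq : (ℤ.1ℤ ℤ.* ℤ.1ℤ ℤ.+ ℤ.+ n ℤ.* ℤ.1ℤ) ℤ.* ℤ.1ℤ ≡ ℤ.+ suc n ℤ.* (ℤ.1ℤ ℤ.* ℤ.1ℤ)
    eq = trans (ℤ.*-identityʳ _) (trans (cong (λ m → ℤ.1ℤ ℤ.+ m) (ℤ.*-identityʳ (ℤ.+ n))) (sym (ℤ.*-identityʳ (ℤ.+ suc n))))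
  natural : ∀ q → ∃ λ n → q ≤ n · 1ℚ
  natural (mkℚ (ℤ.+ n) d c)     = n , subst (mkℚ (ℤ.+ n) d c ≤_) (ι≡· n) (*≤* (ℤ.*-monoˡ-≤-nonNeg (ℤ.+ n) (ℤ.+≤+ (s≤s z≤n))))
  natural (mkℚ ℤ.-[1+ n ] d c)  = 0 , *≤* ℤ.-≤+

≤∧≢⇒< : ∀ {p q} → p ≤ q → p ≢ q → p < q
≤∧≢⇒< p≤q p≢q = ≰⇒> λ q≤p → p≢q (≤-antisym p≤q q≤p)

-- Subdivided intervals

-- A binary tree instead of a list of division points, so that each piece can be subdivided in its
-- place.
data Chain (P : ℚ → ℚ → Set) : ℚ → ℚ → Set where
  single : ∀ {a b} → a < b → P a b → Chain P a b
  join   : ∀ {a m b} → Chain P a m → Chain P m b → Chain P a b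

chain-< : ∀ {P a b} → Chain P a b → a < b
chain-< (single a<b _) = a<b
chain-< (join c d)     = <-trans (chain-< c) (chain-< d)

mapWithin : ∀ {P Q a b} → (∀ {a′ b′} → a ≤ a′ → b′ ≤ b → P a′ b′ → Q a′ b′) → Chain P a b → Chain Q a b
mapWithin f (single a<b p) = single a<b (f ≤-refl ≤-refl p)
mapWithin f (join c d)     = join
  (mapWithin (λ le ge → f le (≤-trans ge (<⇒≤ (chain-< d)))) c)
  (mapWithin (λ le ge → f (≤-trans (<⇒≤ (chain-< c)) le) ge) d)

bindChain : ∀ {P Q a b} → (∀ {a b} → a < b → P a b → Chain Q a b) → Chain P a b → Chain Q a b
bindChain f (single a<b p) = f a<b p
bindChain f (join c d)     = join (bindChain f c) (bindChain f d)

Hereditary : (ℚ → ℚ → Set) → Set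
Hereditary P = ∀ {a b a′ b′} → a ≤ a′ → b′ ≤ b → P a b → P a′ b′

restrict : ∀ {P} → Hereditary P → ∀ {a b a′ b′} → Chain P a b → a ≤ a′ → a′ < b′ → b′ ≤ b → Chain P a′ b′
restrict her (single _ p) a≤a′ a′<b′ b′≤b = single a′<b′ (her a≤a′ b′≤b p)
restrict her {a′ = a′} {b′} (join {m = m} c d) a≤a′ a′<b′ b′≤b with b′ ≤? m | m ≤? a′
... | yes b′≤m | _        = restrict her c a≤a′ a′<b′ b′≤m
... | no  _    | yes m≤a′ = restrict her d m≤a′ a′<b′ b′≤b
... | no b′≰m  | no m≰a′  = join (restrict her c a≤a′ (≰⇒> m≰a′) ≤-refl) (restrict her d ≤-refl (≰⇒> b′≰m) b′≤b)

-- The common refinement, obtained by cutting the second subdivision along the first.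
meet : ∀ {P Q} → Hereditary P → Hereditary Q → ∀ {a b} → Chain P a b → Chain Q a b →
       Chain (λ a b → P a b × Q a b) a b
meet herP herQ (single _ p) d = mapWithin (λ le ge q → herP le ge p , q) d
meet herP herQ (join c c′)  d = join
  (meet herP herQ c  (restrict herQ d ≤-refl (chain-< c) (<⇒≤ (chain-< c′))))
  (meet herP herQ c′ (restrict herQ d (<⇒≤ (chain-< c)) (chain-< c′) ≤-refl))

-- Only one side of c is considered: at a breakpoint the slopes differ, and an orbital lies on one
-- side of each of its ends.
germˡ : ∀ {P} → Hereditary P → ∀ {a b c} → Chain P a b → a < c → c ≤ b → ∃ λ l → a ≤ l × l < c × P l c
germˡ her {a} (single _ p) a<c c≤b = a , ≤-refl , a<c , her ≤-refl c≤b p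
germˡ her {c = c} (join {m = m} e d) a<c c≤b with c ≤? m
... | yes c≤m = germˡ her e a<c c≤m
... | no  c≰m = let (l , m≤l , l<c , p) = germˡ her d (≰⇒> c≰m) c≤b
                in l , ≤-trans (<⇒≤ (chain-< e)) m≤l , l<c , p

germʳ : ∀ {P} → Hereditary P → ∀ {a b c} → Chain P a b → a ≤ c → c < b → ∃ λ r → r ≤ b × c < r × P c r
germʳ her {b = b} (single _ p) a≤c c<b = b , ≤-refl , c<b , her a≤c ≤-refl p
germʳ her {c = c} (join {m = m} e d) a≤c c<b with m ≤? c
... | yes m≤c = germʳ her d m≤c c<b
... | no  m≰c = let (r , r≤m , c<r , p) = germʳ her e a≤c (≰⇒> m≰c)
                in r , ≤-trans r≤m (<⇒≤ (chain-< d)) , c<r , p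

-- Piecewise affine interpolation

affine-hereditary : ∀ {f} → Hereditary (Affine f)
affine-hereditary a≤a′ b′≤b (α , aff) = α , λ a′≤s s≤b′ a′≤t t≤b′ →
  aff (≤-trans a≤a′ a′≤s) (≤-trans s≤b′ b′≤b) (≤-trans a≤a′ a′≤t) (≤-trans t≤b′ b′≤b)

affine-cong : ∀ {f h a b} → (∀ {t} → a ≤ t → t ≤ b → h t ≡ f t) → Affine f a b → Affine h a b
affine-cong {f} {h} h≡f (α , aff) = α , λ {s} {t} a≤s s≤b a≤t t≤b →
  trans (h≡f a≤t t≤b) (trans (aff a≤s s≤b a≤t t≤b) (cong (_+ α * (t - s)) (sym (h≡f a≤s s≤b))))

Interpolant : Aut → List ℚ → (a b a′ b′ : ℚ) → Set
Interpolant f L a b a′ b′ = ∃ λ (h : Aut) → ⟦ h ⟧ a ≡ a′ × ⟦ h ⟧ b ≡ b′ × Chain (Affine ⟦ h ⟧) a b ×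
  (∀ {x} → x ∈ L → a < x → x < b → ⟦ h ⟧ x ≡ ⟦ f ⟧ x)

-- Cut the interval at each entry of `L` inside it and give the cut point its value under `f`. As
-- `f` is increasing, both halves inherit the condition on the values.
interpolate : ∀ f L {a b a′ b′} → a < b → a′ < b′ →
              (∀ {x} → x ∈ L → a < x → x < b → a′ < ⟦ f ⟧ x × ⟦ f ⟧ x < b′) → Interpolant f L a b a′ b′
interpolate f [] a<b a′<b′ _ =
  let (h , ha , hb , aff) = segment a<b a′<b′ in h , ha , hb , single a<b aff , λ ()
interpolate f (x ∷ L) {a} {b} {a′} {b′} a<b a′<b′ within = cases (a <? x) (x <? b)
  where
  skip : ¬ (a < x × x < b) → Interpolant f (x ∷ L) a b a′ b′
  skip x∉ =
    let (h , ha , hb , ch , agree) = interpolate f L a<b a′<b′ (λ y∈ → within (there y∈))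
    in h , ha , hb , ch , λ
      { (here refl) a<x x<b → contradiction (a<x , x<b) x∉
      ; (there y∈)          → agree y∈ }
  split : a < x → x < b → Interpolant f (x ∷ L) a b a′ b′
  split a<x x<b =
    let (a′<fx , fx<b′) = within (here refl) a<x x<b
    in glued (interpolate f L a<x a′<fx (λ y∈ a<y y<x → proj₁ (within (there y∈) a<y (<-trans y<x x<b)) , mono-< f y<x))
             (interpolate f L x<b fx<b′ (λ y∈ x<y y<b → mono-< f x<y , proj₂ (within (there y∈) (<-trans a<x x<y) y<b)))
    where
    glued : Interpolant f L a x a′ (⟦ f ⟧ x) → Interpolant f L x b (⟦ f ⟧ x) b′ → Interpolant f (x ∷ L) a b a′ b′
    glued (h , ha , hx , ch , agree) (k , kx , kb , dk , agree′) =
      glue h k x hx≡kx , trans (left (<⇒≤ a<x)) ha , trans (right (<⇒≤ x<b)) kb ,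
      join (mapWithin (λ _ b′≤x → affine-cong λ _ t≤b′ → left (≤-trans t≤b′ b′≤x)) ch)
           (mapWithin (λ x≤a′ _ → affine-cong λ a′≤t _ → right (≤-trans x≤a′ a′≤t)) dk) ,
      λ { (here refl) _ _      → trans (left ≤-refl) hx
        ; (there y∈) a<y y<b → there-agree y∈ a<y y<b (<-cmp _ x) }
      where
      hx≡kx : ⟦ h ⟧ x ≡ ⟦ k ⟧ x
      hx≡kx = trans hx (sym kx)
      left : ∀ {t} → t ≤ x → ⟦ glue h k x hx≡kx ⟧ t ≡ ⟦ h ⟧ t
      left = glue-≤ h k x hx≡kx
      right : ∀ {t} → x ≤ t → ⟦ glue h k x hx≡kx ⟧ t ≡ ⟦ k ⟧ t
      right = glue-≥ h k x hx≡kx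
      there-agree : ∀ {y} → y ∈ L → a < y → y < b → Tri (y < x) (y ≡ x) (x < y) →
                    ⟦ glue h k x hx≡kx ⟧ y ≡ ⟦ f ⟧ y
      there-agree y∈ a<y y<b (tri< y<x _ _)  = trans (left (<⇒≤ y<x)) (agree y∈ a<y y<x)
      there-agree y∈ a<y y<b (tri≈ _ refl _) = trans (left ≤-refl) hx
      there-agree y∈ a<y y<b (tri> _ _ x<y)  = trans (right (<⇒≤ x<y)) (agree′ y∈ x<y y<b)
  cases : Dec (a < x) → Dec (x < b) → Interpolant f (x ∷ L) a b a′ b′
  cases (yes a<x) (yes x<b) = split a<x x<b
  cases (yes _)   (no x≮b)  = skip λ (_ , x<b) → x≮b x<b
  cases (no a≮x)  _         = skip λ (a<x , _) → a≮x a<x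

-- Sign of the displacement of a piecewise affine map

data Sign (f : ℚ → ℚ) (a b : ℚ) : Set where
  still : (∀ {t} → a ≤ t → t ≤ b → f t ≡ t) → Sign f a b
  up    : (∀ {t} → a < t → t < b → t < f t) → Sign f a b
  down  : (∀ {t} → a < t → t < b → f t < t) → Sign f a b

sign-hereditary : ∀ {f} → Hereditary (Sign f)
sign-hereditary a≤a′ b′≤b (still s) = still λ a′≤t t≤b′ → s (≤-trans a≤a′ a′≤t) (≤-trans t≤b′ b′≤b)
sign-hereditary a≤a′ b′≤b (up s)    = up    λ a′<t t<b′ → s (≤-<-trans a≤a′ a′<t) (<-≤-trans t<b′ b′≤b)
sign-hereditary a≤a′ b′≤b (down s)  = down  λ a′<t t<b′ → s (≤-<-trans a≤a′ a′<t) (<-≤-trans t<b′ b′≤b)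

-[p-q]≡q-p : ∀ p q → - (p - q) ≡ q - p
-[p-q]≡q-p = solve 2 (λ p q → :- (p :- q) := q :- p) refl

p-q≡0⇒p≡q : ∀ {p q} → p - q ≡ 0ℚ → p ≡ q
p-q≡0⇒p≡q {p} {q} eq = trans (sym (p+[q-p]≡q q p)) (trans (cong (q +_) eq) (+-identityʳ q))

p≡q⇒p-q≡0 : ∀ {p q} → p ≡ q → p - q ≡ 0ℚ
p≡q⇒p-q≡0 {p} refl = +-inverseʳ p

sign-up : ∀ {f a b} → a < b → Affine f a b → a ≤ f a → b ≤ f b → Sign f a b
sign-up {f} {a} {b} a<b aff a≤fa b≤fb with f a ≟ a | f b ≟ b
... | yes fa≡a | yes fb≡b = still λ a≤t t≤b → p-q≡0⇒p≡q
  (affine-zero a<b (affine-displacement aff) (p≡q⇒p-q≡0 fa≡a) (p≡q⇒p-q≡0 fb≡b) a≤t t≤b)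
... | no fa≢a | _ = up λ a<t t<b → 0<q-p⇒p<q (affine-pos (affine-displacement aff)
  (p≤q⇒0≤q-p a≤fa) (p≤q⇒0≤q-p b≤fb) (inj₁ (p<q⇒0<q-p (≤∧≢⇒< a≤fa λ eq → fa≢a (sym eq)))) a<t t<b)
... | yes _ | no fb≢b = up λ a<t t<b → 0<q-p⇒p<q (affine-pos (affine-displacement aff)
  (p≤q⇒0≤q-p a≤fa) (p≤q⇒0≤q-p b≤fb) (inj₂ (p<q⇒0<q-p (≤∧≢⇒< b≤fb λ eq → fb≢b (sym eq)))) a<t t<b)

affine-drop : ∀ {f a b} → Affine f a b → Affine (λ t → t - f t) a b
affine-drop {f} aff = affine-cong (λ {t} _ _ → sym (-[p-q]≡q-p (f t) t)) (affine-neg (affine-displacement aff))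

sign-down : ∀ {f a b} → a < b → Affine f a b → f a ≤ a → f b ≤ b → Sign f a b
sign-down {f} {a} {b} a<b aff fa≤a fb≤b with f a ≟ a | f b ≟ b
... | yes fa≡a | yes fb≡b = still λ a≤t t≤b → p-q≡0⇒p≡q
  (affine-zero a<b (affine-displacement aff) (p≡q⇒p-q≡0 fa≡a) (p≡q⇒p-q≡0 fb≡b) a≤t t≤b)
... | no fa≢a | _ = down λ a<t t<b → 0<q-p⇒p<q (affine-pos (affine-drop aff)
  (p≤q⇒0≤q-p fa≤a) (p≤q⇒0≤q-p fb≤b) (inj₁ (p<q⇒0<q-p (≤∧≢⇒< fa≤a fa≢a))) a<t t<b)
... | yes _ | no fb≢b = down λ a<t t<b → 0<q-p⇒p<q (affine-pos (affine-drop aff)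
  (p≤q⇒0≤q-p fa≤a) (p≤q⇒0≤q-p fb≤b) (inj₂ (p<q⇒0<q-p (≤∧≢⇒< fb≤b fb≢b))) a<t t<b)

-- If the displacements at the ends have opposite signs, the interval is cut at the root of the
-- displacement, which is rational.
signs : ∀ {f a b} → a < b → Affine f a b → Chain (Sign f) a b
signs {f} {a} {b} a<b aff = cases (≤-total a (f a)) (≤-total b (f b))
  where
  cases : a ≤ f a ⊎ f a ≤ a → b ≤ f b ⊎ f b ≤ b → Chain (Sign f) a b
  cases (inj₁ a≤fa) (inj₁ b≤fb) = single a<b (sign-up a<b aff a≤fa b≤fb)
  cases (inj₂ fa≤a) (inj₂ fb≤b) = single a<b (sign-down a<b aff fa≤a fb≤b)
  cases (inj₁ a≤fa) (inj₂ fb≤b) with f a ≟ a | f b ≟ b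
  ... | yes fa≡a | _ = single a<b (sign-down a<b aff (≤-reflexive fa≡a) fb≤b)
  ... | no _ | yes fb≡b = single a<b (sign-up a<b aff a≤fa (≤-reflexive (sym fb≡b)))
  ... | no fa≢a | no fb≢b =
    let (t , a<t , t<b , root) = affine-root a<b (affine-drop aff)
          (subst (0ℚ <_) (sym (-[p-q]≡q-p a (f a))) (p<q⇒0<q-p (≤∧≢⇒< a≤fa λ eq → fa≢a (sym eq))))
          (p<q⇒0<q-p (≤∧≢⇒< fb≤b fb≢b))
        ft≡t = sym (p-q≡0⇒p≡q root)
    in join (single a<t (sign-up a<t (affine-hereditary ≤-refl (<⇒≤ t<b) aff) a≤fa (≤-reflexive (sym ft≡t))))
            (single t<b (sign-down t<b (affine-hereditary (<⇒≤ a<t) ≤-refl aff) (≤-reflexive ft≡t) fb≤b))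
  cases (inj₂ fa≤a) (inj₁ b≤fb) with f a ≟ a | f b ≟ b
  ... | yes fa≡a | _ = single a<b (sign-up a<b aff (≤-reflexive (sym fa≡a)) b≤fb)
  ... | no _ | yes fb≡b = single a<b (sign-down a<b aff fa≤a (≤-reflexive fb≡b))
  ... | no fa≢a | no fb≢b =
    let (t , a<t , t<b , root) = affine-root a<b (affine-displacement aff)
          (subst (0ℚ <_) (sym (-[p-q]≡q-p (f a) a)) (p<q⇒0<q-p (≤∧≢⇒< fa≤a fa≢a)))
          (p<q⇒0<q-p (≤∧≢⇒< b≤fb λ eq → fb≢b (sym eq)))
        ft≡t = p-q≡0⇒p≡q root
    in join (single a<t (sign-down a<t (affine-hereditary ≤-refl (<⇒≤ t<b) aff) fa≤a (≤-reflexive ft≡t)))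
            (single t<b (sign-up t<b (affine-hereditary (<⇒≤ a<t) ≤-refl aff) (≤-reflexive (sym ft≡t)) b≤fb))

-- Dynamics of a pair

module Dynamics (π : Pair) where

  Fixed : ℚ → Set
  Fixed x = ∀ i → ⟦ π i ⟧ x ≡ x

  fixed? : ∀ x → Dec (Fixed x)
  fixed? x with ⟦ π 𝐟 ⟧ x ≟ x | ⟦ π 𝐠 ⟧ x ≟ x
  ... | yes fx | yes gx = yes λ { 𝐟 → fx ; 𝐠 → gx }
  ... | no ¬fx | _      = no λ fix → ¬fx (fix 𝐟)
  ... | yes _  | no ¬gx = no λ fix → ¬gx (fix 𝐠)

  act-fixed : ∀ {x} → Fixed x → ∀ ℓ → ⟦ act π ℓ ⟧ x ≡ x
  act-fixed fix (pos i) = fix i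
  act-fixed fix (neg i) = fixed-from (π i) (fix i)

  run-fixed : ∀ {x} → Fixed x → ∀ w → run π w x ≡ x
  run-fixed fix []      = refl
  run-fixed fix (ℓ ∷ w) = trans (cong (run π w) (act-fixed fix ℓ)) (run-fixed fix w)

  data Up (x : ℚ) : Word → ℚ → Set where
    []  : Up x [] x
    _∷_ : ∀ {ℓ w y} → x < ⟦ act π ℓ ⟧ x → Up (⟦ act π ℓ ⟧ x) w y → Up x (ℓ ∷ w) y

  Up-run : ∀ {x w y} → Up x w y → run π w x ≡ y
  Up-run []      = refl
  Up-run (_ ∷ u) = Up-run u

  Up-++ : ∀ {x v y w z} → Up x v y → Up y w z → Up x (v ++ w) z
  Up-++ []      u′ = u′
  Up-++ (s ∷ u) u′ = s ∷ Up-++ u u′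

  -- The inverse of a letter that has just raised the point would lower it again, so an ascending
  -- path cannot use it.
  Up-Red : ∀ {x w y p} → ⟦ act π (opp p) ⟧ x ≤ x → Up x w y → ∃ λ q → Red p w q
  Up-Red _ [] = _ , []
  Up-Red {x} back (_∷_ {ℓ} x<ℓx u) =
    let (q , r) = Up-Red (subst (_≤ ⟦ act π ℓ ⟧ x) (sym (act-opp π ℓ x)) (<⇒≤ x<ℓx)) u
    in q , (λ { refl → <⇒≱ x<ℓx back }) ∷ r

  Up-¬Fixed : ∀ {x w y} → Up x w y → ¬ Fixed x → ¬ Fixed y
  Up-¬Fixed {x} {w} {y} u ¬fix fix = ¬fix (subst Fixed (sym x≡y) fix)
    where
    x≡y : x ≡ y
    x≡y = Aut.injective (word π w) (trans (Up-run u) (sym (run-fixed fix w)))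

  Up-Fixed-< : ∀ {x w y c} → Up x w y → Fixed c → x < c → y < c
  Up-Fixed-< {w = w} u fix x<c = subst₂ _<_ (Up-run u) (run-fixed fix w) (mono-< (word π w) x<c)

  Reach : ℚ → (ℚ → Set) → Set
  Reach x P = ∃₂ λ w y → Up x w y × P y

  flip-up : ∀ i {x} → ⟦ π i ⟧ x < x → x < from (π i) x
  flip-up i {x} fx<x = cancel-< (π i) (subst (⟦ π i ⟧ x <_) (sym (to∘from (π i) x)) fx<x)

  upLetter : ∀ {x} → ¬ Fixed x → ∃ λ ℓ → x < ⟦ act π ℓ ⟧ x
  upLetter {x} ¬fix with <-cmp (⟦ π 𝐟 ⟧ x) x | <-cmp (⟦ π 𝐠 ⟧ x) x
  ... | tri< fx<x _ _ | _             = neg 𝐟 , flip-up 𝐟 fx<x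
  ... | tri> _ _ x<fx | _             = pos 𝐟 , x<fx
  ... | tri≈ _ _ _    | tri< gx<x _ _ = neg 𝐠 , flip-up 𝐠 gx<x
  ... | tri≈ _ _ _    | tri> _ _ x<gx = pos 𝐠 , x<gx
  ... | tri≈ _ fx _   | tri≈ _ gx _   = contradiction (λ { 𝐟 → fx ; 𝐠 → gx }) ¬fix

  -- Inside such an interval either both maps are the identity, or one fixed letter raises every
  -- point.
  Gap : ℚ → ℚ → Set
  Gap a b = ∀ i → Affine ⟦ π i ⟧ a b × Sign ⟦ π i ⟧ a b

  -- The first alternative serves the inverse letters: the displacement of an inverse at x is
  -- governed by that of the generator at the preimage of x, which may lie beyond t, where no bound
  -- is at hand.
  Climbs : Letter → ℚ → ℚ → Set
  Climbs ℓ o t = ∃ λ δ → 0ℚ < δ × (∀ {x} → o ≤ x → x ≤ t → t < ⟦ act π ℓ ⟧ x ⊎ x + δ ≤ ⟦ act π ℓ ⟧ x)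

  q≤p-r⇒r+q≤p : ∀ {p q r} → q ≤ p - r → r + q ≤ p
  q≤p-r⇒r+q≤p {p} {q} {r} le = subst (r + q ≤_) (p+[q-p]≡q r p) (+-monoʳ-≤ r le)

  climbs-up : ∀ i {a b o t} → Affine ⟦ π i ⟧ a b → (∀ {t} → a < t → t < b → t < ⟦ π i ⟧ t) →
              a < o → o < t → t < b → Climbs (pos i) o t
  climbs-up i {a} {b} {o} {t} aff s a<o o<t t<b =
    let (δ , 0<δ , above) = affine-bounded {λ u → ⟦ π i ⟧ u - u} o<t
          (affine-displacement {⟦ π i ⟧} (affine-hereditary (<⇒≤ a<o) (<⇒≤ t<b) aff))
          (p<q⇒0<q-p (s a<o (<-trans o<t t<b))) (p<q⇒0<q-p (s (<-trans a<o o<t) t<b))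
    in δ , 0<δ , λ {x} o≤x x≤t → inj₂ (close {δ} {x} above o≤x x≤t)
    where
    close : ∀ {δ x} → (∀ {u} → o ≤ u → u ≤ t → δ ≤ ⟦ π i ⟧ u - u) → o ≤ x → x ≤ t → x + δ ≤ ⟦ π i ⟧ x
    close {δ} {x} above o≤x x≤t = q≤p-r⇒r+q≤p {⟦ π i ⟧ x} {δ} {x} (above o≤x x≤t)

  climbs-down : ∀ i {a b o t} → Affine ⟦ π i ⟧ a b → (∀ {t} → a < t → t < b → ⟦ π i ⟧ t < t) →
                a < o → o < t → t < b → Climbs (neg i) o t
  climbs-down i {a} {b} {o} {t} aff s a<o o<t t<b =
    let (δ , 0<δ , above) = affine-bounded {λ u → u - ⟦ π i ⟧ u} o<t
          (affine-drop (affine-hereditary (<⇒≤ a<o) (<⇒≤ t<b) aff))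
          (p<q⇒0<q-p (s a<o (<-trans o<t t<b))) (p<q⇒0<q-p (s (<-trans a<o o<t) t<b))
    in δ , 0<δ , λ {x} o≤x x≤t → case o≤x x≤t above (from (π i) x ≤? t)
    where
    case : ∀ {δ x} → o ≤ x → x ≤ t → (∀ {t′} → o ≤ t′ → t′ ≤ t → δ ≤ t′ - ⟦ π i ⟧ t′) →
           Dec (from (π i) x ≤ t) → t < from (π i) x ⊎ x + δ ≤ from (π i) x
    case _ _ _ (no r≰t) = inj₁ (≰⇒> r≰t)
    case {δ} {x} o≤x x≤t above (yes r≤t) = inj₂ (q≤p-r⇒r+q≤p {from (π i) x} {δ} {x}
      (subst (λ u → δ ≤ from (π i) x - u) (to∘from (π i) x) (above (≤-trans o≤x (<⇒≤ x<r)) r≤t)))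
      where
      x<r : x < from (π i) x
      x<r = flip-up i (s (<-≤-trans a<o o≤x) (≤-<-trans x≤t t<b))

  climbs : ∀ {a b o t} → Gap a b → ¬ Fixed o → a < o → o < t → t < b → ∃ λ ℓ → Climbs ℓ o t
  climbs {a} {b} {o} {t} gap ¬fix a<o o<t t<b = cases (proj₂ (gap 𝐟)) (proj₂ (gap 𝐠))
    where
    o<b = <-trans o<t t<b
    cases : Sign ⟦ π 𝐟 ⟧ a b → Sign ⟦ π 𝐠 ⟧ a b → ∃ λ ℓ → Climbs ℓ o t
    cases (up s)    _         = pos 𝐟 , climbs-up 𝐟 (proj₁ (gap 𝐟)) s a<o o<t t<b
    cases (down s)  _         = neg 𝐟 , climbs-down 𝐟 (proj₁ (gap 𝐟)) s a<o o<t t<b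
    cases (still _) (up s)    = pos 𝐠 , climbs-up 𝐠 (proj₁ (gap 𝐠)) s a<o o<t t<b
    cases (still _) (down s)  = neg 𝐠 , climbs-down 𝐠 (proj₁ (gap 𝐠)) s a<o o<t t<b
    cases (still s) (still s′) = contradiction
      (λ { 𝐟 → s (<⇒≤ a<o) (<⇒≤ o<b) ; 𝐠 → s′ (<⇒≤ a<o) (<⇒≤ o<b) }) ¬fix

  climb : ∀ {ℓ o t} → Climbs ℓ o t → o ≤ t → Reach o (t ≤_)
  climb {ℓ} {o} {t} (δ , 0<δ , rises) o≤t =
    let (n , t-o≤nδ) = archimedean (t - o) 0<δ
    in go n ≤-refl o≤t (subst (_≤ o + n · δ) (p+[q-p]≡q o t) (+-monoʳ-≤ o t-o≤nδ))
    where
    go : ∀ n {x} → o ≤ x → x ≤ t → t ≤ x + n · δ → Reach x (t ≤_)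
    next : ∀ n {x} → o ≤ x → x ≤ t → t ≤ x + (δ + n · δ) →
           t < ⟦ act π ℓ ⟧ x ⊎ x + δ ≤ ⟦ act π ℓ ⟧ x → Dec (⟦ act π ℓ ⟧ x ≤ t) → Reach x (t ≤_)
    go zero {x} o≤x x≤t t≤ = [] , x , [] , subst (t ≤_) (+-identityʳ x) t≤
    go (suc n) {x} o≤x x≤t t≤ = next n o≤x x≤t t≤ (rises o≤x x≤t) (⟦ act π ℓ ⟧ x ≤? t)
    next n {x} o≤x x≤t t≤ (inj₁ t<ℓx) _ = ℓ ∷ [] , _ , ≤-<-trans x≤t t<ℓx ∷ [] , <⇒≤ t<ℓx
    next n {x} o≤x x≤t t≤ (inj₂ _) (no ℓx≰t) =
      ℓ ∷ [] , _ , ≤-<-trans x≤t (≰⇒> ℓx≰t) ∷ [] , <⇒≤ (≰⇒> ℓx≰t)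
    next n {x} o≤x x≤t t≤ (inj₂ x+δ≤ℓx) (yes ℓx≤t) =
      let (w , y , u , t≤y) = go n (≤-trans o≤x (<⇒≤ x<ℓx)) ℓx≤t
            (≤-trans (subst (t ≤_) (sym (+-assoc x δ (n · δ))) t≤) (+-monoˡ-≤ (n · δ) x+δ≤ℓx))
      in ℓ ∷ w , y , x<ℓx ∷ u , t≤y
      where
      x<ℓx : x < ⟦ act π ℓ ⟧ x
      x<ℓx = <-≤-trans (0<q⇒p<p+q x 0<δ) x+δ≤ℓx

  reachGap : ∀ {a b o} → Gap a b → ¬ Fixed o → a < o → o < b → ∀ {t} → t < b → Reach o (t <_)
  reachGap {o = o} gap ¬fix a<o o<b {t} t<b with t <? o
  ... | yes t<o = [] , o , [] , t<o
  ... | no  t≮o =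
    let (t′ , t<t′ , t′<b)    = <-dense t<b
        o<t′                  = ≤-<-trans (≮⇒≥ t≮o) t<t′
        (ℓ , cl)              = climbs gap ¬fix a<o o<t′ t′<b
        (w , y , u , t′≤y)    = climb {ℓ} cl (<⇒≤ o<t′)
    in w , y , u , <-≤-trans t<t′ t′≤y

  Limit : ℚ → ℚ → Set
  Limit y c = Fixed c × y < c × (∀ {t} → t < c → Reach y (t <_))

  prepend : ∀ {x ℓ P} → x < ⟦ act π ℓ ⟧ x → Reach (⟦ act π ℓ ⟧ x) P → Reach x P
  prepend {ℓ = ℓ} s (w , y , u , p) = ℓ ∷ w , y , s ∷ u , p

  -- Within a gap, paths climb arbitrarily close to its right end. If that end is not fixed, some
  -- letter raises it and takes nearby points across, and the climb continues in the next gap.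
  climbChain : ∀ {a b y} → Chain Gap a b → a ≤ y → y < b → ¬ Fixed y →
               (∃ λ c → c ≤ b × Limit y c) ⊎ Reach y (b ≤_)
  climbChain {a} {b} {y} (single _ gap) a≤y y<b ¬fix =
    -- Since y may be the left end, where `Sign` gives no strict inequality, one letter is spent on
    -- entering the interior.
    let (ℓ , y<ℓy) = upLetter ¬fix in start ℓ y<ℓy (b ≤? ⟦ act π ℓ ⟧ y)
    where
    start : ∀ ℓ → y < ⟦ act π ℓ ⟧ y → Dec (b ≤ ⟦ act π ℓ ⟧ y) → (∃ λ c → c ≤ b × Limit y c) ⊎ Reach y (b ≤_)
    start ℓ y<y₁ (yes b≤y₁) = inj₂ (ℓ ∷ [] , _ , y<y₁ ∷ [] , b≤y₁)
    start ℓ y<y₁ (no b≰y₁)  = end (fixed? b)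
      where
      reach : ∀ {t} → t < b → Reach y (t <_)
      reach t<b = prepend {ℓ = ℓ} y<y₁ (reachGap gap (Up-¬Fixed (_∷_ {ℓ = ℓ} y<y₁ []) ¬fix) (≤-<-trans a≤y y<y₁) (≰⇒> b≰y₁) t<b)
      cross : ∀ ℓ → b < ⟦ act π ℓ ⟧ b → Reach y (b ≤_)
      cross ℓ b<ℓb = last (reach t<b)
        where
        -- Every point above the preimage of b is taken across b by `ℓ`.
        t = from (act π ℓ) b
        t<b : t < b
        t<b = cancel-< (act π ℓ) (subst (_< ⟦ act π ℓ ⟧ b) (sym (to∘from (act π ℓ) b)) b<ℓb)
        last : Reach y (t <_) → Reach y (b ≤_)
        last (w , z , u , t<z) with b ≤? z
        ... | yes b≤z = w , z , u , b≤z
        ... | no  b≰z = w ++ ℓ ∷ [] , _ , Up-++ u (<-trans (≰⇒> b≰z) b<ℓz ∷ []) , <⇒≤ b<ℓz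
          where
          b<ℓz : b < ⟦ act π ℓ ⟧ z
          b<ℓz = subst (_< ⟦ act π ℓ ⟧ z) (to∘from (act π ℓ) b) (mono-< (act π ℓ) t<z)
      end : Dec (Fixed b) → (∃ λ c → c ≤ b × Limit y c) ⊎ Reach y (b ≤_)
      end (yes fix) = inj₁ (b , ≤-refl , fix , y<b , reach)
      end (no ¬fixb) = let (ℓ , b<ℓb) = upLetter ¬fixb in inj₂ (cross ℓ b<ℓb)
  climbChain {a} {b} {y} (join {m = m} c d) a≤y y<b ¬fix = left (y <? m)
    where
    m≤b = <⇒≤ (chain-< d)
    right : ∀ {w z} → Up y w z → m ≤ z → Dec (z < b) → (∃ λ c → c ≤ b × Limit y c) ⊎ Reach y (b ≤_)
    right {w} {z} u m≤z (no z≮b) = inj₂ (w , z , u , ≮⇒≥ z≮b)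
    right {w} {z} u m≤z (yes z<b) with climbChain d m≤z z<b (Up-¬Fixed u ¬fix)
    ... | inj₁ (c , c≤b , fix , z<c , reach) =
      inj₁ (c , c≤b , fix , ≤-<-trans (y≤z u) z<c , λ t<c → let (w′ , x , u′ , t<x) = reach t<c in w ++ w′ , x , Up-++ u u′ , t<x)
      where
      y≤z : ∀ {y w z} → Up y w z → y ≤ z
      y≤z []      = ≤-refl
      y≤z (s ∷ u) = ≤-trans (<⇒≤ s) (y≤z u)
    ... | inj₂ (w′ , x , u′ , b≤x) = inj₂ (w ++ w′ , x , Up-++ u u′ , b≤x)
    left : Dec (y < m) → (∃ λ c → c ≤ b × Limit y c) ⊎ Reach y (b ≤_)
    left (no y≮m) = right [] (≮⇒≥ y≮m) (yes y<b)
    left (yes y<m) with climbChain c a≤y y<m ¬fix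
    ... | inj₁ (c , c≤m , lim) = inj₁ (c , ≤-trans c≤m m≤b , lim)
    ... | inj₂ (w , z , u , m≤z) = right u m≤z (z <? b)

  gap-¬Fixed : ∀ {a b y} → Gap a b → a < y → y ≤ b → ¬ Fixed y → ∀ {t} → a < t → t < b → ¬ Fixed t
  gap-¬Fixed {a} {b} {y} gap a<y y≤b ¬fix {t} a<t t<b fix = cases (proj₂ (gap 𝐟)) (proj₂ (gap 𝐠))
    where
    cases : Sign ⟦ π 𝐟 ⟧ a b → ¬ Sign ⟦ π 𝐠 ⟧ a b
    cases (up s)    _         = <-irrefl (sym (fix 𝐟)) (s a<t t<b)
    cases (down s)  _         = <-irrefl (fix 𝐟) (s a<t t<b)
    cases (still _) (up s)    = <-irrefl (sym (fix 𝐠)) (s a<t t<b)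
    cases (still _) (down s)  = <-irrefl (fix 𝐠) (s a<t t<b)
    cases (still s) (still s′) = ¬fix λ { 𝐟 → s (<⇒≤ a<y) y≤b ; 𝐠 → s′ (<⇒≤ a<y) y≤b }

  LastFixed : ℚ → ℚ → Set
  LastFixed c y = Fixed c × c < y × (∀ {t} → c < t → t ≤ y → ¬ Fixed t)

  -- Search downwards gap by gap: to the left of an unfixed point a gap can have no common fixed
  -- point but its left end. If that end is unfixed too, it serves as the unfixed point for the
  -- preceding gap.
  lastFixed : ∀ {a b y} → Chain Gap a b → a < y → y ≤ b → ¬ Fixed y →
              (∃ λ c → a ≤ c × LastFixed c y) ⊎ (∀ {t} → a ≤ t → t ≤ y → ¬ Fixed t)
  lastFixed {a} {b} {y} (single _ gap) a<y y≤b ¬fix = cases (fixed? a)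
    where
    inside : ∀ {t} → a < t → t ≤ y → ¬ Fixed t
    inside {t} a<t t≤y with t ≟ y
    ... | yes refl = ¬fix
    ... | no t≢y   = gap-¬Fixed gap a<y y≤b ¬fix a<t (<-≤-trans (≤∧≢⇒< t≤y t≢y) y≤b)
    cases : Dec (Fixed a) → (∃ λ c → a ≤ c × LastFixed c y) ⊎ (∀ {t} → a ≤ t → t ≤ y → ¬ Fixed t)
    cases (yes fix) = inj₁ (a , ≤-refl , fix , a<y , inside)
    cases (no ¬fixa) = inj₂ bounded
      where
      bounded : ∀ {t} → a ≤ t → t ≤ y → ¬ Fixed t
      bounded {t} a≤t t≤y with a ≟ t
      ... | yes refl = ¬fixa
      ... | no a≢t   = inside (≤∧≢⇒< a≤t a≢t) t≤y
  lastFixed {a} {b} {y} (join {m = m} e d) a<y y≤b ¬fix with y ≤? m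
  ... | yes y≤m = lastFixed e a<y y≤m ¬fix
  ... | no y≰m with lastFixed d (≰⇒> y≰m) y≤b ¬fix
  ...   | inj₁ (c , m≤c , last) = inj₁ (c , ≤-trans (<⇒≤ (chain-< e)) m≤c , last)
  ...   | inj₂ none with lastFixed e (chain-< e) ≤-refl (none ≤-refl (<⇒≤ (≰⇒> y≰m)))
  ...     | inj₁ (c , a≤c , fix , c<m , above) =
    inj₁ (c , a≤c , fix , <-trans c<m (≰⇒> y≰m) , λ {t} c<t t≤y → split c<t t≤y (t ≤? m))
    where
    split : ∀ {t} → c < t → t ≤ y → Dec (t ≤ m) → ¬ Fixed t
    split c<t t≤y (yes t≤m) = above c<t t≤m
    split c<t t≤y (no t≰m)  = none (<⇒≤ (≰⇒> t≰m)) t≤y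
  ...     | inj₂ below = inj₂ λ {t} a≤t t≤y → split a≤t t≤y (t ≤? m)
    where
    split : ∀ {t} → a ≤ t → t ≤ y → Dec (t ≤ m) → ¬ Fixed t
    split a≤t t≤y (yes t≤m) = below a≤t t≤m
    split a≤t t≤y (no t≰m)  = none (<⇒≤ (≰⇒> t≰m)) t≤y

  -- The field `cofinal` is stronger than the absence of common fixed points in between, which over
  -- ℚ would still allow paths to accumulate at an irrational cut.
  record Orbital : Set where
    field
      {bot top} : ℚ
      fix-bot   : Fixed bot
      fix-top   : Fixed top
      cofinal   : ∀ {a b} → bot < a → a < top → b < top → Reach a (b <_)

  orbital : ∀ {lo hi y} → Chain Gap lo hi → Fixed lo → Fixed hi → lo < y → y < hi → ¬ Fixed y →
            ∃ λ (O : Orbital) → let open Orbital O in lo ≤ bot × top ≤ hi × bot < y × y < top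
  orbital {lo} {hi} {y} ch fix-lo fix-hi lo<y y<hi ¬fix =
    build (lastFixed ch lo<y (<⇒≤ y<hi) ¬fix) (climbChain ch (<⇒≤ lo<y) y<hi ¬fix)
    where
    Result = ∃ λ (O : Orbital) → let open Orbital O in lo ≤ bot × top ≤ hi × bot < y × y < top
    build : (∃ λ c → lo ≤ c × LastFixed c y) ⊎ (∀ {t} → lo ≤ t → t ≤ y → ¬ Fixed t) →
            (∃ λ c → c ≤ hi × Limit y c) ⊎ Reach y (hi ≤_) → Result
    build (inj₂ none) _ = contradiction fix-lo (none ≤-refl (<⇒≤ lo<y))
    build _ (inj₂ (w , z , u , hi≤z)) = contradiction hi≤z (<⇒≱ (Up-Fixed-< u fix-hi y<hi))
    build (inj₁ (c , lo≤c , fix-c , c<y , above)) (inj₁ (d , d≤hi , fix-d , y<d , reach)) =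
      record { fix-bot = fix-c ; fix-top = fix-d ; cofinal = cofinal } , lo≤c , d≤hi , c<y , y<d
      where
      none : ∀ {t} → c < t → t < d → ¬ Fixed t
      none {t} c<t t<d fix with t ≤? y
      ... | yes t≤y = above c<t t≤y fix
      ... | no t≰y  = let (w , z , u , t<z) = reach t<d in <-asym t<z (Up-Fixed-< u fix (≰⇒> t≰y))
      cofinal : ∀ {a b} → c < a → a < d → b < d → Reach a (b <_)
      cofinal {a} {b} c<a a<d b<d with climbChain ch (≤-trans lo≤c (<⇒≤ c<a)) (<-≤-trans a<d d≤hi) (none c<a a<d)
      ... | inj₂ (w , z , u , hi≤z) = contradiction hi≤z (<⇒≱ (Up-Fixed-< u fix-hi (<-≤-trans a<d d≤hi)))
      ... | inj₁ (e , _ , fix-e , a<e , reach′) =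
        reach′ (<-≤-trans b<d (≮⇒≥ λ e<d → none (<-trans c<a a<e) e<d fix-e))

-- Moving finite sets towards the ends of orbitals

upper₂ : ∀ {c} x y → x < c → y < c → ∃ λ m → m < c × x ≤ m × y ≤ m
upper₂ x y x<c y<c with ≤-total x y
... | inj₁ x≤y = y , y<c , x≤y , ≤-refl
... | inj₂ y≤x = x , x<c , ≤-refl , y≤x

lower₂ : ∀ {c} x y → c < x → c < y → ∃ λ m → c < m × m ≤ x × m ≤ y
lower₂ x y c<x c<y with ≤-total x y
... | inj₁ x≤y = x , c<x , ≤-refl , x≤y
... | inj₂ y≤x = y , c<y , y≤x , ≤-refl

other : Letter → Gen
other (pos 𝐟) = 𝐠
other (neg 𝐟) = 𝐠
other (pos 𝐠) = 𝐟
other (neg 𝐠) = 𝐟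

module Escape (π : Pair) (lo hi : ℚ) (gaps : Chain (Dynamics.Gap π) lo hi)
              (fix-lo : Dynamics.Fixed π lo) (fix-hi : Dynamics.Fixed π hi) where
  open Dynamics π
  open Orbital

  run-bot< : ∀ (O : Orbital) w {z} → bot O < z → bot O < run π w z
  run-bot< O w bot<z = subst (_< run π w _) (run-fixed (fix-bot O) w) (mono-< (word π w) bot<z)

  run-<top : ∀ (O : Orbital) w {z} → z < top O → run π w z < top O
  run-<top O w z<top = subst (run π w _ <_) (run-fixed (fix-top O) w) (mono-< (word π w) z<top)

  -- Such properties are closed under conjunction and under precomposition with a word, as words fix
  -- the ends of orbitals. The induction in `escape` relies on both.
  record EndGood (G : ℚ → Set) : Set where
    field
      at-fixed : ∀ {z} → Fixed z → G z
      at-ends  : ∀ (O : Orbital) → lo ≤ bot O → top O ≤ hi → bot O < top O →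
                 ∃₂ λ a b → bot O < a × a < top O × b < top O ×
                   (∀ {z} → bot O < z → z < top O → z < a ⊎ b < z → G z)

  open EndGood

  good-× : ∀ {G H} → EndGood G → EndGood H → EndGood (λ z → G z × H z)
  good-× eg eh = record
    { at-fixed = λ fix → at-fixed eg fix , at-fixed eh fix
    ; at-ends  = λ O lo≤ ≤hi bot<top →
        let (a , b , bot<a , a<top , b<top , g)        = at-ends eg O lo≤ ≤hi bot<top
            (a′ , b′ , bot<a′ , a′<top , b′<top , h)   = at-ends eh O lo≤ ≤hi bot<top
            (m , bot<m , m≤a , m≤a′)                   = lower₂ a a′ bot<a bot<a′
            (n , n<top , b≤n , b′≤n)                   = upper₂ b b′ b<top b′<top
        in m , n , bot<m , ≤-<-trans m≤a a<top , n<top , λ bot<z z<top → λ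
          { (inj₁ z<m) → g bot<z z<top (inj₁ (<-≤-trans z<m m≤a)) , h bot<z z<top (inj₁ (<-≤-trans z<m m≤a′))
          ; (inj₂ n<z) → g bot<z z<top (inj₂ (≤-<-trans b≤n n<z)) , h bot<z z<top (inj₂ (≤-<-trans b′≤n n<z)) }
    }

  good-run : ∀ {G} w → EndGood G → EndGood (λ z → G (run π w z))
  good-run {G} w eg = record
    { at-fixed = λ fix → subst G (sym (run-fixed fix w)) (at-fixed eg fix)
    ; at-ends  = λ O lo≤ ≤hi bot<top →
        let (a , b , bot<a , a<top , b<top , g) = at-ends eg O lo≤ ≤hi bot<top
        in from h a , from h b ,
           cancel-< h (subst₂ _<_ (sym (run-fixed (fix-bot O) w)) (sym (to∘from h a)) bot<a) ,
           cancel-< h (subst₂ _<_ (sym (to∘from h a)) (sym (run-fixed (fix-top O) w)) a<top) ,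
           cancel-< h (subst₂ _<_ (sym (to∘from h b)) (sym (run-fixed (fix-top O) w)) b<top) ,
           λ {z} bot<z z<top → λ
             { (inj₁ z<a) → g (run-bot< O w bot<z) (run-<top O w z<top)
                              (inj₁ (subst (run π w z <_) (to∘from h a) (mono-< h z<a)))
             ; (inj₂ b<z) → g (run-bot< O w bot<z) (run-<top O w z<top)
                              (inj₂ (subst (_< run π w z) (to∘from h b) (mono-< h b<z))) }
    }
    where h = word π w

  -- First apply a letter of the other generator that does not move a down;
  -- an upward path from there is reduced.
  reducedUp : ∀ (O : Orbital) {a b} → bot O < a → a < top O → b < top O →
              ∀ p → ∃₂ λ u q → Red p u q × b < run π u a
  reducedUp O {a} {b} bot<a a<top b<top p = go (a ≤? ⟦ π j ⟧ a)
    where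
    j = other p
    pos≢ : ∀ p → pos (other p) ≢ opp p
    pos≢ (pos 𝐟) ()
    pos≢ (neg 𝐟) ()
    pos≢ (pos 𝐠) ()
    pos≢ (neg 𝐠) ()
    neg≢ : ∀ p → neg (other p) ≢ opp p
    neg≢ (pos 𝐟) ()
    neg≢ (neg 𝐟) ()
    neg≢ (pos 𝐠) ()
    neg≢ (neg 𝐠) ()
    via : ∀ ℓ → ℓ ≢ opp p → a ≤ ⟦ act π ℓ ⟧ a → ∃₂ λ u q → Red p u q × b < run π u a
    via ℓ ne a≤ℓa =
      let (w , y , u , b<y) = cofinal O (run-bot< O (ℓ ∷ []) bot<a) (run-<top O (ℓ ∷ []) a<top) b<top
          (q , red)         = Up-Red {p = ℓ} (subst (_≤ ⟦ act π ℓ ⟧ a) (sym (act-opp π ℓ a)) a≤ℓa) u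
      in ℓ ∷ w , q , ne ∷ red , subst (b <_) (sym (Up-run u)) b<y
    go : Dec (a ≤ ⟦ π j ⟧ a) → ∃₂ λ u q → Red p u q × b < run π u a
    go (yes a≤ja) = via (pos j) (pos≢ p) a≤ja
    go (no a≰ja)  = via (neg j) (neg≢ p) (<⇒≤ (flip-up j (≰⇒> a≰ja)))

  -- In `escape` the word to append depends on the last letter of a word that is not yet
  -- constructed. There are four possible letters, so all of them are provided for in advance.
  good-letters : ∀ {G} (u : Letter → Word) → EndGood G → EndGood (λ z → ∀ p → G (run π (u p) z))
  good-letters u eg = record
    { at-fixed = λ fix p → at-fixed (good-run (u p) eg) fix
    ; at-ends  = λ O lo≤ ≤hi bot<top →
        let (a , b , bot<a , a<top , b<top , g) = at-ends all O lo≤ ≤hi bot<top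
        in a , b , bot<a , a<top , b<top , λ bot<z z<top out → λ
          { (pos 𝐟) → proj₁ (proj₁ (g bot<z z<top out)) ; (neg 𝐟) → proj₂ (proj₁ (g bot<z z<top out))
          ; (pos 𝐠) → proj₁ (proj₂ (g bot<z z<top out)) ; (neg 𝐠) → proj₂ (proj₂ (g bot<z z<top out)) }
    }
    where
    all = good-× (good-× (good-run (u (pos 𝐟)) eg) (good-run (u (neg 𝐟)) eg))
                 (good-× (good-run (u (pos 𝐠)) eg) (good-run (u (neg 𝐠)) eg))

  -- Given y with orbital O, let G hold on O outside [a, b] and let u carry a above b.
  -- Moving the remaining points to where both G and G ∘ u hold leaves the choice
  -- of applying u at the end, as needed for y.
  escape : ∀ {G} → EndGood G → ∀ Y → (∀ {y} → y ∈ Y → lo < y × y < hi) →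
           ∀ p → ∃₂ λ v q → Red p v q × (∀ {y} → y ∈ Y → G (run π v y))
  escape eg [] _ p = [] , p , [] , λ ()
  escape {G} eg (y ∷ Y) within p = cases (fixed? y)
    where
    Result = ∃₂ λ v q → Red p v q × (∀ {x} → x ∈ y ∷ Y → G (run π v x))
    moving : (O : Orbital) → lo ≤ bot O → top O ≤ hi → bot O < y → y < top O → Result
    moving O lo≤ ≤hi bot<y y<top =
      let (a , b , bot<a , a<top , b<top , g) = at-ends eg O lo≤ ≤hi (<-trans bot<y y<top)
          carry                             = reducedUp O bot<a a<top b<top
          u                                 = λ p → proj₁ (carry p)
          (v , q , red , good)              = escape (good-× eg (good-letters u eg)) Y (λ y∈ → within (there y∈)) p
      in decide a b g carry v q red good (a ≤? run π v y)
      where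
      decide : ∀ a b → (∀ {z} → bot O < z → z < top O → z < a ⊎ b < z → G z) →
               (carry : ∀ p → ∃₂ λ u q → Red p u q × b < run π u a) →
               ∀ v q → Red p v q → (∀ {x} → x ∈ Y → G (run π v x) × (∀ r → G (run π (proj₁ (carry r)) (run π v x)))) →
               Dec (a ≤ run π v y) → Result
      decide a b g carry v q red good (no a≰vy) = v , q , red , λ
        { (here refl) → g (run-bot< O v bot<y) (run-<top O v y<top) (inj₁ (≰⇒> a≰vy))
        ; (there x∈)  → proj₁ (good x∈) }
      decide a b g carry v q red good (yes a≤vy) =
        let (u , r , red′ , b<ua) = carry q
        in v ++ u , r , Red-++ red red′ , λ
          { (here refl) → subst G (sym (run-++ π v u y))
              (g (run-bot< O u (run-bot< O v bot<y)) (run-<top O u (run-<top O v y<top))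
                 (inj₂ (<-≤-trans b<ua (Aut.mono (word π u) a≤vy))))
          ; (there {_} x∈) → subst G (sym (run-++ π v u _)) (proj₂ (good x∈) q) }
    cases : Dec (Fixed y) → Result
    cases (yes fix) =
      let (v , q , red , good) = escape eg Y (λ y∈ → within (there y∈)) p
      in v , q , red , λ
        { (here refl) → subst G (sym (run-fixed fix v)) (at-fixed eg fix)
        ; (there x∈)  → good x∈ }
    cases (no ¬fix) =
      let (lo<y , y<hi) = within (here refl)
          (O , lo≤ , ≤hi , bot<y , y<top) = orbital gaps fix-lo fix-hi lo<y y<hi ¬fix
      in moving O lo≤ ≤hi bot<y y<top

  Commute : ℚ → Set
  Commute z = ⟦ π 𝐟 ⟧ (⟦ π 𝐠 ⟧ z) ≡ ⟦ π 𝐠 ⟧ (⟦ π 𝐟 ⟧ z)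

  -- Both maps are linear about their common fixed point c.
  affine-commute : ∀ {l r c z} → Fixed c → l ≤ c → c ≤ r →
                   Affine ⟦ π 𝐟 ⟧ l r → Affine ⟦ π 𝐠 ⟧ l r →
                   l ≤ z → z ≤ r → (∀ i → l ≤ ⟦ π i ⟧ z) → (∀ i → ⟦ π i ⟧ z ≤ r) → Commute z
  affine-commute {l} {r} {c} {z} fix l≤c c≤r (α , af) (β , ag) l≤z z≤r l≤ ≤r =
    trans (trans (f-at (l≤ 𝐠) (≤r 𝐠)) (cong (λ u → c + α * (u - c)) (g-at l≤z z≤r)))
          (trans (solve 4 (λ c α β u → c :+ α :* ((c :+ β :* u) :- c) := c :+ β :* ((c :+ α :* u) :- c)) refl c α β (z - c))
                 (sym (trans (g-at (l≤ 𝐟) (≤r 𝐟)) (cong (λ u → c + β * (u - c)) (f-at l≤z z≤r)))))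
    where
    f-at : ∀ {t} → l ≤ t → t ≤ r → ⟦ π 𝐟 ⟧ t ≡ c + α * (t - c)
    f-at {t} l≤t t≤r = trans (af l≤c c≤r l≤t t≤r) (cong (_+ α * (t - c)) (fix 𝐟))
    g-at : ∀ {t} → l ≤ t → t ≤ r → ⟦ π 𝐠 ⟧ t ≡ c + β * (t - c)
    g-at {t} l≤t t≤r = trans (ag l≤c c≤r l≤t t≤r) (cong (_+ β * (t - c)) (fix 𝐠))

  gap-affine : ∀ i → Chain (Affine ⟦ π i ⟧) lo hi
  gap-affine i = mapWithin (λ _ _ gap → proj₁ (gap i)) gaps

  top-commute : ∀ {c} → lo < c → c ≤ hi → Fixed c → ∃ λ b → b < c × (∀ {z} → b < z → z < c → Commute z)
  top-commute {c} lo<c c≤hi fix =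
    let (l₁ , _ , l₁<c , af) = germˡ affine-hereditary (gap-affine 𝐟) lo<c c≤hi
        (l₂ , _ , l₂<c , ag) = germˡ affine-hereditary (gap-affine 𝐠) lo<c c≤hi
        (l , l<c , l₁≤l , l₂≤l) = upper₂ l₁ l₂ l₁<c l₂<c
        -- Above the preimages of l both maps stay above l, so the second map applied is still
        -- evaluated where it is affine.
        (k , k<c , fl≤k , gl≤k) = upper₂ _ _ (back 𝐟 l<c) (back 𝐠 l<c)
        (b , b<c , l≤b , k≤b)   = upper₂ l k l<c k<c
    in b , b<c , λ b<z z<c → affine-commute {l} {c} fix (<⇒≤ l<c) ≤-refl
         (affine-hereditary l₁≤l ≤-refl af) (affine-hereditary l₂≤l ≤-refl ag)
         (≤-trans l≤b (<⇒≤ b<z)) (<⇒≤ z<c)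
         (λ { 𝐟 → forth 𝐟 (≤-trans fl≤k (≤-trans k≤b (<⇒≤ b<z)))
            ; 𝐠 → forth 𝐠 (≤-trans gl≤k (≤-trans k≤b (<⇒≤ b<z))) })
         (λ i → subst (⟦ π i ⟧ _ ≤_) (fix i) (Aut.mono (π i) (<⇒≤ z<c)))
    where
    back : ∀ i {l} → l < c → from (π i) l < c
    back i l<c = cancel-< (π i) (subst₂ _<_ (sym (to∘from (π i) _)) (sym (fix i)) l<c)
    forth : ∀ i {l z} → from (π i) l ≤ z → l ≤ ⟦ π i ⟧ z
    forth i {l} {z} le = subst (_≤ ⟦ π i ⟧ z) (to∘from (π i) l) (Aut.mono (π i) le)

  bot-commute : ∀ {c} → lo ≤ c → c < hi → Fixed c → ∃ λ a → c < a × (∀ {z} → c < z → z < a → Commute z)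
  bot-commute {c} lo≤c c<hi fix =
    let (r₁ , _ , c<r₁ , af) = germʳ affine-hereditary (gap-affine 𝐟) lo≤c c<hi
        (r₂ , _ , c<r₂ , ag) = germʳ affine-hereditary (gap-affine 𝐠) lo≤c c<hi
        (r , c<r , r≤r₁ , r≤r₂) = lower₂ r₁ r₂ c<r₁ c<r₂
        (k , c<k , k≤fr , k≤gr) = lower₂ _ _ (back 𝐟 c<r) (back 𝐠 c<r)
        (a , c<a , a≤r , a≤k)   = lower₂ r k c<r c<k
    in a , c<a , λ c<z z<a → affine-commute {c} {r} fix ≤-refl (<⇒≤ c<r)
         (affine-hereditary ≤-refl r≤r₁ af) (affine-hereditary ≤-refl r≤r₂ ag)
         (<⇒≤ c<z) (≤-trans (<⇒≤ z<a) a≤r)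
         (λ i → subst (_≤ ⟦ π i ⟧ _) (fix i) (Aut.mono (π i) (<⇒≤ c<z)))
         (λ { 𝐟 → forth 𝐟 (≤-trans (<⇒≤ z<a) (≤-trans a≤k k≤fr))
            ; 𝐠 → forth 𝐠 (≤-trans (<⇒≤ z<a) (≤-trans a≤k k≤gr)) })
    where
    back : ∀ i {r} → c < r → c < from (π i) r
    back i c<r = cancel-< (π i) (subst₂ _<_ (sym (fix i)) (sym (to∘from (π i) _)) c<r)
    forth : ∀ i {r z} → z ≤ from (π i) r → ⟦ π i ⟧ z ≤ r
    forth i {r} {z} le = subst (⟦ π i ⟧ z ≤_) (to∘from (π i) r) (Aut.mono (π i) le)

  good-Commute : EndGood Commute
  good-Commute = record
    { at-fixed = λ fix → trans (cong ⟦ π 𝐟 ⟧ (fix 𝐠)) (trans (fix 𝐟) (sym (trans (cong ⟦ π 𝐠 ⟧ (fix 𝐟)) (fix 𝐠))))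
    ; at-ends  = λ O lo≤ ≤hi bot<top →
        let (a , bot<a , near-bot) = bot-commute lo≤ (<-≤-trans bot<top ≤hi) (fix-bot O)
            (b , b<top , near-top) = top-commute (≤-<-trans lo≤ bot<top) ≤hi (fix-top O)
            -- The neighbourhood of the bottom may reach beyond `top O`; cutting it at m keeps its
            -- bound inside the orbital.
            (m , bot<m , m<top)    = <-dense bot<top
            (a′ , bot<a′ , a′≤a , a′≤m) = lower₂ a m bot<a bot<m
        in a′ , b , bot<a′ , ≤-<-trans a′≤m m<top , b<top , λ bot<z z<top → λ
          { (inj₁ z<a′) → near-bot bot<z (<-≤-trans z<a′ a′≤a)
          ; (inj₂ b<z)  → near-top b<z z<top }
    }

  -- For a conjugating word ending in q: the commutator starts with q and ends with the other
  -- generator, so that neither joint with that word and its inverse cancels.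
  commutator : Letter → Word
  commutator q = q ∷ pos (other q) ∷ opp q ∷ neg (other q) ∷ []

  -- Commutation at a preimage of z lets the inverse letter commute with the other generator at z,
  -- as the commutator requires when q is an inverse.
  Central : ℚ → Set
  Central z = Commute z × Commute (from (π 𝐟) z) × Commute (from (π 𝐠) z)

  good-Central : EndGood Central
  good-Central = good-× good-Commute
    (good-× (good-run (neg 𝐟 ∷ []) good-Commute) (good-run (neg 𝐠 ∷ []) good-Commute))

  commutator-fixes : ∀ q {z} → Central z → run π (commutator q) z ≡ z
  commutator-fixes q {z} cen =
    trans (cong (λ u → from (π (other q)) (⟦ act π (opp q) ⟧ u)) (commutes q cen))
    (trans (cong (from (π (other q))) (act-opp π q (⟦ π (other q) ⟧ z))) (from∘to (π (other q)) z))
    where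
    inverse-commutes : ∀ (h k : Aut) {z} → ⟦ h ⟧ (⟦ k ⟧ (from h z)) ≡ ⟦ k ⟧ (⟦ h ⟧ (from h z)) →
                       ⟦ k ⟧ (from h z) ≡ from h (⟦ k ⟧ z)
    inverse-commutes h k {z} eq = Aut.injective h
      (trans eq (trans (cong ⟦ k ⟧ (to∘from h z)) (sym (to∘from h (⟦ k ⟧ z)))))
    commutes : ∀ q → Central z → ⟦ π (other q) ⟧ (⟦ act π q ⟧ z) ≡ ⟦ act π q ⟧ (⟦ π (other q) ⟧ z)
    commutes (pos 𝐟) (e , _ , _) = sym e
    commutes (pos 𝐠) (e , _ , _) = e
    commutes (neg 𝐟) (_ , e , _) = inverse-commutes (π 𝐟) (π 𝐠) e
    commutes (neg 𝐠) (_ , _ , e) = inverse-commutes (π 𝐠) (π 𝐟) (sym e)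

-- Fixing a finite set by a conjugate of a commutator

opp-involutive : ∀ ℓ → opp (opp ℓ) ≡ ℓ
opp-involutive (pos i) = refl
opp-involutive (neg i) = refl

-- The inverse of the word p ∷ w is opp q ∷ w′.
inverseWord : ∀ π {p w q} → Red p w q →
  ∃ λ w′ → Red (opp q) w′ (opp p) × (∀ x → run π w′ (⟦ act π (opp q) ⟧ (run π w (⟦ act π p ⟧ x))) ≡ x)
inverseWord π {p} [] = [] , [] , act-opp π p
inverseWord π {p} (_∷_ {ℓ} {w} {q} ne red) =
  let (w′ , red′ , undo) = inverseWord π red
  in w′ ++ opp p ∷ [] , Red-++ red′ ((λ eq → ne (sym (trans eq (opp-involutive ℓ)))) ∷ []) ,
     λ x → trans (run-++ π w′ (opp p ∷ []) _) (trans (cong ⟦ act π (opp p) ⟧ (undo (⟦ act π p ⟧ x))) (act-opp π p x))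

-- The final `opp q` is the first letter of the inverse of the conjugating word, which `inverseWord`
-- splits off.
commutator-Red : ∀ q → Red q (q ∷ pos (other q) ∷ opp q ∷ neg (other q) ∷ opp q ∷ []) (opp q)
commutator-Red (pos 𝐟) = (λ ()) ∷ (λ ()) ∷ (λ ()) ∷ (λ ()) ∷ (λ ()) ∷ []
commutator-Red (pos 𝐠) = (λ ()) ∷ (λ ()) ∷ (λ ()) ∷ (λ ()) ∷ (λ ()) ∷ []
commutator-Red (neg 𝐟) = (λ ()) ∷ (λ ()) ∷ (λ ()) ∷ (λ ()) ∷ (λ ()) ∷ []
commutator-Red (neg 𝐠) = (λ ()) ∷ (λ ()) ∷ (λ ()) ∷ (λ ()) ∷ (λ ()) ∷ []

stabilize : ∀ π L F N → ∃ λ π′ → Agree (λ _ → L) π π′ ×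
  ∃₂ λ w q → Red (pos 𝐟) w q × (∀ {y} → y ∈ F → run π′ (replicate (suc N) (pos 𝐟) ++ w) y ≡ y)
stabilize π L F N =
  -- The images of `L` are enclosed as well, so that the interpolants can fix lo and hi.
  let (lo , hi , lo<hi , within) = bounds (L ++ F ++ map ⟦ π 𝐟 ⟧ L ++ map ⟦ π 𝐠 ⟧ L)
  in build lo hi
       (λ x∈ → within (∈-++⁺ʳ L (∈-++⁺ˡ x∈)))
       (λ x∈ → within (∈-++⁺ˡ x∈))
       (interpolate (π 𝐟) L lo<hi lo<hi λ x∈ _ _ →
          within (∈-++⁺ʳ L (∈-++⁺ʳ F (∈-++⁺ˡ (∈-map⁺ ⟦ π 𝐟 ⟧ x∈)))))
       (interpolate (π 𝐠) L lo<hi lo<hi λ x∈ _ _ →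
          within (∈-++⁺ʳ L (∈-++⁺ʳ F (∈-++⁺ʳ (map ⟦ π 𝐟 ⟧ L) (∈-map⁺ ⟦ π 𝐠 ⟧ x∈)))))
  where
  power : Word
  power = replicate (suc N) (pos 𝐟)
  build : ∀ lo hi → (∀ {x} → x ∈ F → lo < x × x < hi) → (∀ {x} → x ∈ L → lo < x × x < hi) →
          Interpolant (π 𝐟) L lo hi lo hi → Interpolant (π 𝐠) L lo hi lo hi →
          ∃ λ π′ → Agree (λ _ → L) π π′ ×
          ∃₂ λ w q → Red (pos 𝐟) w q × (∀ {y} → y ∈ F → run π′ (power ++ w) y ≡ y)
  build lo hi F-in L-in (h , hlo , hhi , h-chain , h-agree) (k , klo , khi , k-chain , k-agree) =
    π′ , (λ { 𝐟 d∈ → let (lo< , <hi) = L-in d∈ in h-agree d∈ lo< <hi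
            ; 𝐠 d∈ → let (lo< , <hi) = L-in d∈ in k-agree d∈ lo< <hi }) ,
    -- The power comes first in the word, so it is its image of `F` that has to escape, by a
    -- continuation that stays reduced after `pos 𝐟`.
    conjugate (escape good-Central (map (run π′ power) F) in-range (pos 𝐟))
    where
    π′ : Pair
    π′ 𝐟 = h
    π′ 𝐠 = k
    signed : ∀ {f} → Chain (Affine f) lo hi → Chain (λ a b → Affine f a b × Sign f a b) lo hi
    signed c = meet affine-hereditary sign-hereditary c (bindChain signs c)
    gaps : Chain (Dynamics.Gap π′) lo hi
    gaps = mapWithin (λ { _ _ (p , q) 𝐟 → p ; _ _ (p , q) 𝐠 → q })
      (meet (λ le ge (p , q) → affine-hereditary le ge p , sign-hereditary le ge q)
            (λ le ge (p , q) → affine-hereditary le ge p , sign-hereditary le ge q)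
            (signed h-chain) (signed k-chain))
    fix-lo : Dynamics.Fixed π′ lo
    fix-lo 𝐟 = hlo
    fix-lo 𝐠 = klo
    fix-hi : Dynamics.Fixed π′ hi
    fix-hi 𝐟 = hhi
    fix-hi 𝐠 = khi
    open Dynamics π′
    open Escape π′ lo hi gaps fix-lo fix-hi
    in-range : ∀ {y} → y ∈ map (run π′ power) F → lo < y × y < hi
    in-range y∈ with ∈-map⁻ (run π′ power) y∈
    ... | x , x∈ , refl = let (lo<x , x<hi) = F-in x∈ in
      subst (_< run π′ power x) (run-fixed fix-lo power) (mono-< (word π′ power) lo<x) ,
      subst (run π′ power x <_) (run-fixed fix-hi power) (mono-< (word π′ power) x<hi)
    conjugate : (∃₂ λ v q → Red (pos 𝐟) v q × (∀ {y} → y ∈ map (run π′ power) F → Central (run π′ v y))) →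
                ∃₂ λ w q → Red (pos 𝐟) w q × (∀ {y} → y ∈ F → run π′ (power ++ w) y ≡ y)
    conjugate (v , q , red , central) =
      let (w′ , red′ , undo) = inverseWord π′ (Red-++ (Red-replicate N 𝐟) red)
      in v ++ (commutator q ++ opp q ∷ []) ++ w′ , neg 𝐟 , Red-++ red (Red-++ (commutator-Red q) red′) ,
         λ {y} y∈ →
           trans (run-++ π′ power (v ++ (commutator q ++ opp q ∷ []) ++ w′) y)
          (trans (run-++ π′ v ((commutator q ++ opp q ∷ []) ++ w′) (run π′ power y))
          (trans (cong (λ z → run π′ w′ (⟦ act π′ (opp q) ⟧ z)) (commutator-fixes q (central (∈-map⁺ (run π′ power) y∈))))
          (trans (cong (λ z → run π′ w′ (⟦ act π′ (opp q) ⟧ z)) (sym (run-++ π′ (replicate N (pos 𝐟)) v (⟦ h ⟧ y))))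
                 (undo y))))

-- Enumerating finite lists of rationals

increment : List ℕ → List ℕ
increment []       = []
increment (n ∷ ns) = suc n ∷ ns

-- A binary numeral is read as a program: one digit opens a new entry 0, the other increments the
-- first entry.
naturals : ℕᵇ → List ℕ
naturals zero     = []
naturals 2[1+ b ] = 0 ∷ naturals b
naturals 1+[2 b ] = increment (naturals b)

naturals-surjective : ∀ ns → ∃ λ b → naturals b ≡ ns
naturals-surjective []       = zero , refl
naturals-surjective (n ∷ ns) = let (b , eq) = naturals-surjective ns in code n b eq
  where
  code : ∀ n b → naturals b ≡ ns → ∃ λ b′ → naturals b′ ≡ n ∷ ns
  code zero    b eq = 2[1+ b ] , cong (0 ∷_) eq
  code (suc n) b eq = let (b′ , eq′) = code n b eq in 1+[2 b′ ] , cong increment eq′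

rationals : List ℕ → List ℚ
rationals (m ∷ n ∷ d ∷ ns) = (m ℤ.⊖ n) / suc d ∷ rationals ns
rationals _                = []

rationals-surjective : ∀ qs → ∃ λ ns → rationals ns ≡ qs
rationals-surjective [] = [] , refl
rationals-surjective (q@(mkℚ (ℤ.+ m) d _) ∷ qs) =
  let (ns , eq) = rationals-surjective qs in m ∷ 0 ∷ d ∷ ns , cong₂ _∷_ (↥p/↧p≡p q) eq
rationals-surjective (q@(mkℚ ℤ.-[1+ n ] d _) ∷ qs) =
  let (ns , eq) = rationals-surjective qs in 0 ∷ suc n ∷ d ∷ ns , cong₂ _∷_ (↥p/↧p≡p q) eq

enum : ℕ → List ℚ
enum n = rationals (naturals (fromℕ n))

enum-surjective : ∀ qs → ∃ λ n → enum n ≡ qs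
enum-surjective qs =
  let (ns , eq)  = rationals-surjective qs
      (b , eq′) = naturals-surjective ns
  in toℕ b , trans (cong (λ c → rationals (naturals c)) (fromℕ-toℕ b)) (trans (cong rationals eq′) eq)

-- Nowhere dense sets of pairs

pair : Aut × Aut → Pair
pair (f , g) 𝐟 = f
pair (f , g) 𝐠 = g

AgreeOn : List ℚ → Pair → Pair → Set
AgreeOn L = Agree (λ _ → L)

-- A basic open set inside the closure of `S` contains a member of `S`. It therefore suffices to
-- perturb members, which makes the defining property of `S` available to the perturbation.
nowhereDense : (S : Pred (Aut × Aut) 0ℓ) →
  (∀ {fg} → S fg → ∀ L → ∃ λ π → AgreeOn L (pair fg) π ×
     ∃ λ L′ → ∀ {fg′} → AgreeOn L′ π (pair fg′) → ¬ S fg′) →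
  Space.NowhereDense (Aut-space ×ₜ Aut-space) S
nowhereDense S separate x ((p , q) , x∈pq , pq⊆S̄) =
  let (fg , (f∈p , g∈q) , fg∈S) = pq⊆S̄ {x} x∈pq (p , q) x∈pq
      L                        = map proj₁ (graph p) ++ map proj₁ (graph q)
      (π , agree , L′ , avoid) = separate fg∈S L
      π𝐟∈p = extends {proj₁ fg} {π 𝐟} (λ x∈ → agree 𝐟 (∈-++⁺ˡ x∈)) f∈p
      π𝐠∈q = extends {proj₂ fg} {π 𝐠} (λ x∈ → agree 𝐠 (∈-++⁺ʳ (map proj₁ (graph p)) x∈)) g∈q
      (fg′ , (f′∈ , g′∈) , fg′∈S) = pq⊆S̄ {π 𝐟 , π 𝐠} (π𝐟∈p , π𝐠∈q)
        (part (π 𝐟) L′ , part (π 𝐠) L′) (part-∈ (π 𝐟) L′ , part-∈ (π 𝐠) L′)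
  in avoid {fg′} (λ { 𝐟 → part-agree (π 𝐟) L′ {proj₁ fg′} f′∈ ; 𝐠 → part-agree (π 𝐠) L′ {proj₂ fg′} g′∈ }) fg′∈S
  where
  open FinitePartialIso using (graph)
  extends : ∀ {f h : Aut} {ps} → (∀ {x} → x ∈ map proj₁ ps → ⟦ h ⟧ x ≡ ⟦ f ⟧ x) → f ⊇ᵍ ps → h ⊇ᵍ ps
  extends agree []       = []
  extends {f} {h} agree (e ∷ es) = trans (agree (here refl)) e ∷ extends {f} {h} (λ x∈ → agree (there x∈)) es
  graphOn : Aut → List ℚ → List (ℚ × ℚ)
  graphOn h = map λ x → x , ⟦ h ⟧ x
  graphOn-⊇ : ∀ h L → h ⊇ᵍ graphOn h L
  graphOn-⊇ h []      = []
  graphOn-⊇ h (_ ∷ L) = refl ∷ graphOn-⊇ h L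
  part : Aut → List ℚ → FinitePartialIso
  part h L = fromGraph h (graphOn h L) (graphOn-⊇ h L)
  part-∈ : ∀ h L → U (part h L) h
  part-∈ = graphOn-⊇
  part-agree : ∀ h L {k} → U (part h L) k → ∀ {d} → d ∈ L → ⟦ k ⟧ d ≡ ⟦ h ⟧ d
  part-agree h (_ ∷ _) (e ∷ es) (here refl) = e
  part-agree h (_ ∷ L) {k} (e ∷ es) (there d∈)  = part-agree h L {k} es d∈

run-local : ∀ π w x → ∃ λ L → ∀ {π′} → AgreeOn L π π′ → run π′ w x ≡ run π w x
run-local π [] x = [] , λ _ → refl
run-local π (pos i ∷ w) x =
  let (L , local) = run-local π w (⟦ π i ⟧ x)
  in x ∷ L , λ {π′} agree → trans (cong (run π′ w) (agree i (here refl))) (local λ j d∈ → agree j (there d∈))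
run-local π (neg i ∷ w) x =
  let (L , local) = run-local π w r
  in r ∷ L , λ {π′} agree → trans
       (cong (run π′ w) (trans (cong (from (π′ i)) (sym (trans (agree i (here refl)) (to∘from (π i) x)))) (from∘to (π′ i) r)))
       (local λ j d∈ → agree j (there d∈))
  where r = from (π i) x

Fixes : Pair → Word → List ℚ → Set
Fixes π w F = ∀ {y} → y ∈ F → run π w y ≡ y

fixes-local : ∀ π w F → Fixes π w F → ∃ λ L → ∀ {π′} → AgreeOn L π π′ → Fixes π′ w F
fixes-local π w []      _   = [] , λ _ ()
fixes-local π w (y ∷ F) fix =
  let (L , local)   = run-local π w y
      (L′ , local′) = fixes-local π w F (λ y∈ → fix (there y∈))
  in L ++ L′ , λ agree → λ
       { (here refl) → trans (local λ i d∈ → agree i (∈-++⁺ˡ d∈)) (fix (here refl))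
       ; (there y∈)  → local′ (λ i d∈ → agree i (∈-++⁺ʳ L d∈)) y∈ }

-- Topologically similar pairs

Generates : Aut × Aut → Pred Aut 0ℓ
Generates (f , g) = Generated Aut-ℚ f g

letter∈ : ∀ fg ℓ → Generates fg (act (pair fg) ℓ)
letter∈ fg (pos 𝐟) = gen₁
letter∈ fg (pos 𝐠) = gen₂
letter∈ fg (neg 𝐟) = inv gen₁
letter∈ fg (neg 𝐠) = inv gen₂

word∈ : ∀ fg w → Generates fg (word (pair fg) w)
word∈ fg []      = unit
word∈ fg (ℓ ∷ w) = mult (word∈ fg w) (letter∈ fg ℓ)

module _ (fg hk : Aut × Aut) where
  private
    X = generatedSpace Aut-ℚ (proj₁ fg) (proj₂ fg)
    Y = generatedSpace Aut-ℚ (proj₁ hk) (proj₂ hk)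
    module X = Space X
    module Y = Space Y

  -- Continuity at the identity: the pointwise stabilizer of `F` is open, and a basic neighbourhood
  -- of the identity consists of the elements fixing a finite set. Only the values on words enter,
  -- so this serves `φ` and its inverse alike.
  continuous⇒fixes : (ψ : X.Carrier → Y.Carrier) → Continuous X Y ψ →
    (∀ w x∈ → ψ (word (pair fg) w , x∈) Y.≈ (word (pair hk) w , word∈ hk w)) →
    ∀ F → ∃ λ F′ → ∀ w → Fixes (pair fg) w F′ → Fixes (pair hk) w F
  continuous⇒fixes ψ cont ψ-word F =
    let (p , id∈p , p⊆) = cont O (λ {h} → O-open {h}) {idᵃ , unit} (λ {y} _ → ψ-word [] unit y)
    in map proj₁ (FinitePartialIso.graph p) , λ w fix {y} y∈ →
         trans (sym (ψ-word w (word∈ fg w) y)) (p⊆ {word (pair fg) w , word∈ fg w} (extends w id∈p fix) y∈)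
    where
    O : Pred Y.Carrier 0ℓ
    O (h , _) = ∀ {y} → y ∈ F → ⟦ h ⟧ y ≡ y
    diagonal : List ℚ → List (ℚ × ℚ)
    diagonal = map λ y → y , y
    diagonal-⊇ : ∀ h F → (∀ {y} → y ∈ F → ⟦ h ⟧ y ≡ y) → h ⊇ᵍ diagonal F
    diagonal-⊇ h []      fix = []
    diagonal-⊇ h (y ∷ F) fix = fix (here refl) ∷ diagonal-⊇ h F (λ y∈ → fix (there y∈))
    diagonal-⊆ : ∀ h F → h ⊇ᵍ diagonal F → ∀ {y} → y ∈ F → ⟦ h ⟧ y ≡ y
    diagonal-⊆ h (y ∷ F) (e ∷ es) (here refl) = e
    diagonal-⊆ h (y ∷ F) (e ∷ es) (there y∈)  = diagonal-⊆ h F es y∈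
    O-open : Y.Open O
    O-open {h , _} fix = fromGraph h (diagonal F) (diagonal-⊇ h F fix) , diagonal-⊇ h F fix ,
      λ {k} k⊇ → diagonal-⊆ (proj₁ k) F k⊇
    extends : ∀ w {ps} → idᵃ ⊇ᵍ ps → Fixes (pair fg) w (map proj₁ ps) → word (pair fg) w ⊇ᵍ ps
    extends w []       fix = []
    extends w (e ∷ es) fix = trans (fix (here refl)) e ∷ extends w es (λ y∈ → fix (there y∈))

module Similar (fg hk : Aut × Aut) (sim : TopologicallySimilar Aut-ℚ fg hk) where
  open TopologicallySimilar sim
  open IsHomeomorphism isHomeomorphism
  open GroupMorphisms.IsGroupIsomorphism isGroupIsomorphism using (∙-homo; ε-homo; ⁻¹-homo; ⟦⟧-cong)
  private
    letterOf : Letter → Σ Aut (Generates fg)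
    letterOf ℓ = act (pair fg) ℓ , letter∈ fg ℓ
    wordOf : Word → Σ Aut (Generates fg)
    wordOf w = word (pair fg) w , word∈ fg w

  φ-letter : ∀ ℓ → proj₁ (φ (letterOf ℓ)) ≈ act (pair hk) ℓ
  φ-letter (pos 𝐟) = φ-g₁
  φ-letter (pos 𝐠) = φ-g₂
  φ-letter (neg 𝐟) x = trans (⁻¹-homo (letterOf (pos 𝐟)) x)
    (Group.⁻¹-cong Aut-group {proj₁ (φ (letterOf (pos 𝐟)))} {proj₁ hk} φ-g₁ x)
  φ-letter (neg 𝐠) x = trans (⁻¹-homo (letterOf (pos 𝐠)) x)
    (Group.⁻¹-cong Aut-group {proj₁ (φ (letterOf (pos 𝐠)))} {proj₂ hk} φ-g₂ x)

  φ-word : ∀ w → proj₁ (φ (wordOf w)) ≈ word (pair hk) w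
  φ-word []      x = ε-homo x
  φ-word (ℓ ∷ w) x = trans (∙-homo (wordOf w) (letterOf ℓ) x)
    (trans (cong ⟦ proj₁ (φ (wordOf w)) ⟧ (φ-letter ℓ x)) (φ-word w (⟦ act (pair hk) ℓ ⟧ x)))

  forth : ∀ F → ∃ λ F′ → ∀ w → Fixes (pair fg) w F′ → Fixes (pair hk) w F
  forth = continuous⇒fixes fg hk φ continuous λ w x∈ x →
    trans (⟦⟧-cong {word (pair fg) w , x∈} {wordOf w} (λ _ → refl) x) (φ-word w x)

  back : ∀ F → ∃ λ F′ → ∀ w → Fixes (pair hk) w F′ → Fixes (pair fg) w F
  back = continuous⇒fixes hk fg f⁻¹ f⁻¹-continuous λ w x∈ →
    proj₂ inverse {wordOf w} {word (pair hk) w , x∈} λ x → sym (φ-word w x)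

-- The two cases and the countable covers

Extendable : Pair → List ℚ → ℕ → Set
Extendable π F N = ∃₂ λ w q → Red (pos 𝐟) w q × Fixes π (replicate (suc N) (pos 𝐟) ++ w) F

theorem3p13 : ExcludedMiddle 0ℓ →
    ∀ (f₁ g₁ : Aut) →
    Space.Meager (Aut-space ×ₜ Aut-space)
      (λ (f , g) → TopologicallySimilar Aut-ℚ (f , g) (f₁ , g₁))
theorem3p13 em f₁ g₁ = cases em
  where
  π₁ = pair (f₁ , g₁)
  Meager = Space.Meager (Aut-space ×ₜ Aut-space)
             (λ (f , g) → TopologicallySimilar Aut-ℚ (f , g) (f₁ , g₁))

  module Blocked (F : List ℚ) (N : ℕ) (blocked : ¬ Extendable π₁ F N) where
    -- Similarity preserves words letter by letter, so the exponent is the same for all similar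
    -- pairs and only the finite set has to be enumerated.
    S : ℕ → Pred (Aut × Aut) 0ℓ
    S n fg = ¬ Extendable (pair fg) (enum n) N
    meager : Meager
    meager = S , (λ n → nowhereDense (S n) λ {fg} _ L →
        let (π , agree , w , q , red , fix) = stabilize (pair fg) L (enum n) N
            (L′ , local) = fixes-local π (replicate (suc N) (pos 𝐟) ++ w) (enum n) fix
        in π , agree , L′ , λ agree′ ¬ext → ¬ext (w , q , red , local agree′)) ,
      λ {fg} sim →
        let (F′ , transfer) = Similar.forth fg (f₁ , g₁) sim F
            (n , enum-n)    = enum-surjective F′
        in n , λ (w , q , red , fix) → blocked (w , q , red ,
             transfer (replicate (suc N) (pos 𝐟) ++ w) (λ y∈ → fix (subst (_ ∈_) (sym enum-n) y∈)))

  module Free (free : ∀ F N → Extendable π₁ F N) where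
    -- The head of the list is a moved point, the tail a finite set that controls it. The empty list
    -- stands for the pairs with trivial first entry, which have no moved point to offer.
    S : List ℚ → Pred (Aut × Aut) 0ℓ
    S []      fg = ∀ x → ⟦ pair fg 𝐟 ⟧ x ≡ x
    S (x ∷ F) fg = ⟦ pair fg 𝐟 ⟧ x ≢ x × (∀ w → Fixes π₁ w F → run (pair fg) w x ≡ x)

    S-nowhereDense : ∀ F → Space.NowhereDense (Aut-space ×ₜ Aut-space) (S F)
    S-nowhereDense [] = nowhereDense (S []) λ {fg} _ L →
      -- A point z below all of `L` carries no prescribed value, so the first map can be made to
      -- move it.
      let (z , _ , _ , within) = bounds L
          (h , agree , hz∉)    = perturb (pair fg 𝐟) L (λ z∈L → <-irrefl refl (proj₁ (within z∈L))) (z ∷ [])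
      in update (pair fg) 𝐟 h , (λ { 𝐟 → agree ; 𝐠 _ → refl }) , z ∷ [] ,
         λ agree′ id → hz∉ (here (trans (sym (agree′ 𝐟 (here refl))) (id z)))
    S-nowhereDense (x ∷ F) = nowhereDense (S (x ∷ F)) λ {fg} (fx≢x , _) L →
      let (π , w , agree , fix , wx≢x) = moveOff em (λ w → Fixes π₁ w F) (free F) (pair fg) L fx≢x
          (L′ , local)                 = run-local π w x
      in π , agree , L′ , λ agree′ (_ , fixes) → wx≢x (trans (sym (local agree′)) (fixes w fix))

    covered : ∀ {fg} → TopologicallySimilar Aut-ℚ fg (f₁ , g₁) →
              Dec (∃ λ x → ⟦ pair fg 𝐟 ⟧ x ≢ x) → ∃ λ n → S (enum n) fg
    covered {fg} sim (no none) =
      let (n , enum-n) = enum-surjective []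
      in n , subst (λ F → S F fg) (sym enum-n) λ x → decidable-stable em λ fx≢x → none (x , fx≢x)
    covered {fg} sim (yes (x , fx≢x)) =
      let (F , transfer) = Similar.back fg (f₁ , g₁) sim (x ∷ [])
          (n , enum-n)   = enum-surjective (x ∷ F)
      in n , subst (λ F → S F fg) (sym enum-n) (fx≢x , λ w fix → transfer w fix (here refl))

    meager : Meager
    meager = (λ n → S (enum n)) , (λ n → S-nowhereDense (enum n)) , λ {fg} sim → covered {fg} sim em

  cases : Dec (∃₂ λ F N → ¬ Extendable π₁ F N) → Meager
  cases (yes (F , N , blocked)) = Blocked.meager F N blocked
  cases (no none) = Free.meager λ F N → decidable-stable em λ blocked → none (F , N , blocked)
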